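{- With $\beta=q+q^{ -1}$, the matrices $A$ and $A^*$ satisfy $$A^3A^*-(\beta+1)A^2A^*A+(\beta+1)AA^*A^2-A^*A^3=q^{N+M-2}(q+1)^2(AA^*-A^*A),$$ $$(A^*)^2A-\beta A^*AA^*+A(A^*)^2=0.$$
   Context: Let $\mathbb F_q$ be a finite field with $q$ elements, let $N,M$ be positive integers, let $H$ be a vector space over $\mathbb F_q$ of dimension $N+M$, and fix a subspace $h\subseteq H$ of dimension $M$. Let $X$ be the set of subspaces $y\subseteq H$ with $y\cap h=0$, partially ordered by inclusion (the Attenuated Space poset $\mathcal A_q(N,M)$). For $y,z\in X$, $z$ covers $y$ when $y\subseteq z$ and $\dim z-\dim y=1$; $y,z$ are adjacent when one of them covers the other. Let $\mathrm{Mat}_X(\mathbb C)$ be the algebra of complex matrices with rows and columns indexed by $X$. The matrix $A\in\mathrm{Mat}_X(\mathbb C)$ has $(y,z)$-entry $1$ if $y$ covers $z$; $q^{\dim y}$ if $z$ covers $y$; and $0$ if $y,z$ are not adjacent. The matrix $A^*\in\mathrm{Mat}_X(\mathbb C)$ is diagonal with $(y,y)$-entry $q^{ -\dim y}$ for $y\in X$. -}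

module Defs where

open import Level using (Level; _⊔_; 0ℓ) renaming (suc to lsuc)
open import Data.Nat.Base using (ℕ; zero; suc; _≤_; _<_; z≤n; s≤s; _^_) renaming (_+_ to _+ℕ_)
import Data.Nat.Properties as ℕₚ
open import Data.Fin.Base using (Fin; zero; suc; combine; finToFun; funToFin)
open import Data.Fin.Properties using (any?; all?; finToFun-funToFin; funToFin-finToFin; injective⇒≤)
import Data.Fin.Properties as Finₚ
open import Data.Bool.Base using (if_then_else_)
open import Data.Maybe.Base using (Maybe; just; nothing)
open import Data.Maybe.Relation.Unary.Any using () renaming (Any to MaybeAny; just to just′)
open import Data.List.Base using (List; []; _∷_; length; lookup; mapMaybe; deduplicate; allFin)
import Data.List.Membership.Setoid as Membership
import Data.List.Membership.Setoid.Properties as Memₚ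
open import Data.List.Membership.Propositional.Properties using (∈-allFin)
open import Data.List.Relation.Unary.All using (All; _∷_)
open import Data.List.Relation.Unary.AllPairs using (_∷_)
open import Data.List.Relation.Unary.Any as Any using (Any)
import Data.List.Relation.Unary.Any.Properties as Anyₚ
open import Data.List.Relation.Unary.Enumerates.Setoid using (IsEnumeration)
import Data.List.Relation.Unary.Unique.Setoid as Uniq
import Data.List.Relation.Unary.Unique.DecSetoid.Properties as DecUniqₚ
open import Data.Product.Base using (Σ; ∃; _×_; _,_; proj₁; proj₂)
open import Data.Unit.Base using (⊤; tt)
open import Data.Vec.Functional using (Vector; head; tail) renaming (_∷_ to _∷ᵛ_)
open import Function.Base using (_∘_)
open import Function.Bundles using (Inverse)
open import Relation.Binary.Bundles using (Setoid; DecSetoid)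
open import Relation.Binary.PropositionalEquality as ≡ using (_≡_; _≗_)
open import Relation.Nullary using (¬_; Dec; yes; no; does; contradiction)
open import Relation.Nullary.Decidable using (map′; _×-dec_; _→-dec_; ¬?; decidable-stable)
open import Relation.Unary using (Pred; Decidable)
open import Algebra.Bundles using (CommutativeRing)
open import Algebra.Module.Bundles using (Module)
import Algebra.Definitions
import Algebra.Properties.CommutativeMonoid.Sum as Summation
import Algebra.Properties.Group as GroupProperties
import Algebra.Properties.Monoid.Mult as Multiples
import Algebra.Properties.Semiring.Exp as Exponentiation
import Relation.Binary.Reasoning.Setoid as SetoidReasoning

HasSize : ∀ {a ℓ} → Setoid a ℓ → ℕ → Set (a ⊔ ℓ)
HasSize S n = Inverse (≡.setoid (Fin n)) S

module FiniteSetoid {a ℓ : Level} {S : Setoid a ℓ} {n : ℕ} (size : HasSize S n) where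
  open Setoid S
  open Inverse size public using (to; from; from-cong)

  to-from : ∀ x → to (from x) ≈ x
  to-from x = Inverse.strictlyInverseˡ size x

  from-to : ∀ i → from (to i) ≡ i
  from-to i = Inverse.strictlyInverseʳ size i

  from-injective : ∀ {x y} → from x ≡ from y → x ≈ y
  from-injective {x} {y} eq =
    trans (sym (to-from x)) (trans (reflexive (≡.cong to eq)) (to-from y))

  infix 4 _≟_
  _≟_ : ∀ x y → Dec (x ≈ y)
  x ≟ y = map′ from-injective from-cong (from x Finₚ.≟ from y)

  module _ {p} {P : Pred Carrier p} (resp : ∀ {x y} → x ≈ y → P x → P y) (P? : Decidable P) where

    ∃? : Dec (∃ P)
    ∃? = map′ (λ (i , p) → to i , p)
              (λ (x , p) → from x , resp (sym (to-from x)) p)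
              (any? (λ i → P? (to i)))

    ∀? : Dec (∀ x → P x)
    ∀? = map′ (λ f x → resp (to-from x) (f (from x)))
              (λ f i → f (to i))
              (all? (λ i → P? (to i)))

module _ {a ℓ : Level} (S : Setoid a ℓ) where
  open Setoid S
  open Membership S using (_∈_)

  lookupAll : ∀ {p} {P : Pred Carrier p} {xs} → All P xs → ∀ j → P (lookup xs j)
  lookupAll (px ∷ _)  zero    = px
  lookupAll (_ ∷ pxs) (suc j) = lookupAll pxs j

  lookup-injective : ∀ {xs} → Uniq.Unique S xs → ∀ {i j} → lookup xs i ≈ lookup xs j → i ≡ j
  lookup-injective (x∉ ∷ u) {zero}  {zero}  eq = ≡.refl
  lookup-injective (x∉ ∷ u) {zero}  {suc j} eq = contradiction eq (lookupAll x∉ j)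
  lookup-injective (x∉ ∷ u) {suc i} {zero}  eq = contradiction (sym eq) (lookupAll x∉ i)
  lookup-injective (x∉ ∷ u) {suc i} {suc j} eq = ≡.cong suc (lookup-injective u eq)

  enumeration⇒size : ∀ xs → IsEnumeration S xs → Uniq.Unique S xs → HasSize S (length xs)
  enumeration⇒size xs enum unique = record
    { to        = lookup xs
    ; from      = from
    ; to-cong   = λ { ≡.refl → refl }
    ; from-cong = λ {x} {y} x≈y →
        lookup-injective unique (trans (to-from x) (trans x≈y (sym (to-from y))))
    ; inverse   = (λ { {x} ≡.refl → to-from x })
                , (λ {i} {x} x≈i → lookup-injective unique (trans (to-from x) x≈i))
    }
    where
    from : Carrier → Fin (length xs)
    from x = Any.index (enum x)
    to-from : ∀ x → lookup xs (from x) ≈ x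
    to-from x = sym (Anyₚ.lookup-index (enum x))

module Matrices
  {a ℓ k ℓk : Level} {S : Setoid a ℓ} {n : ℕ} (size : HasSize S n) (K : CommutativeRing k ℓk) where

  open Setoid S using () renaming (Carrier to I)
  open CommutativeRing K
  open Summation +-commutativeMonoid using (sum)

  -- Entries are given on all representatives; equality of matrices is then
  -- equality at every pair of representatives, and the product sums over one
  -- representative of each class.
  Mat : Set (a ⊔ k)
  Mat = I → I → Carrier

  infix  4 _≈ₘ_
  infixl 6 _+ₘ_ _-ₘ_
  infixl 7 _*ₘ_
  infixr 7 _•_

  _≈ₘ_ : Mat → Mat → Set (a ⊔ ℓk)
  P ≈ₘ Q = ∀ y z → P y z ≈ Q y z

  0ₘ : Mat
  0ₘ y z = 0#

  _+ₘ_ : Mat → Mat → Mat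
  (P +ₘ Q) y z = P y z + Q y z

  _-ₘ_ : Mat → Mat → Mat
  (P -ₘ Q) y z = P y z - Q y z

  _•_ : Carrier → Mat → Mat
  (s • P) y z = s * P y z

  _*ₘ_ : Mat → Mat → Mat
  (P *ₘ Q) y z = sum (λ i → P y (Inverse.to size i) * Q (Inverse.to size i) z)

module _ {k ℓk : Level} (K : CommutativeRing k ℓk) where
  open CommutativeRing K

  fromℕ : ℕ → Carrier
  fromℕ j = Multiples._×_ +-monoid j 1#

  InvertibleIn : ℕ → Set (k ⊔ ℓk)
  InvertibleIn j = Algebra.Definitions.Invertible _≈_ 1# _*_ (fromℕ j)

record FiniteField (q : ℕ) (c ℓ : Level) : Set (lsuc (c ⊔ ℓ)) where
  field
    commutativeRing : CommutativeRing c ℓ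
  open CommutativeRing commutativeRing hiding (zero) public
  field
    1≉0     : ¬ 1# ≈ 0#
    inverse : ∀ x → ¬ x ≈ 0# → ∃ λ y → y * x ≈ 1#
    size    : HasSize setoid q

module LinearAlgebra
  {c ℓ m ℓm : Level} (R : CommutativeRing c ℓ) (V : Module R m ℓm) where

  open CommutativeRing R hiding (zero)
  open Module V
  open Summation +ᴹ-commutativeMonoid using (sum)

  -- Membership is required to be decidable; over a finite V this is
  -- classically no restriction.
  record IsSubspace (P : Pred Carrierᴹ 0ℓ) : Set (c ⊔ m ⊔ ℓm) where
    field
      ∈?   : Decidable P
      resp : ∀ {v w} → v ≈ᴹ w → P v → P w
      0∈   : P 0ᴹ
      +∈   : ∀ {v w} → P v → P w → P (v +ᴹ w)
      *∈   : ∀ a {v} → P v → P (a *ₗ v)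

  record Subspace : Set (c ⊔ m ⊔ ℓm ⊔ lsuc 0ℓ) where
    field
      Mem        : Pred Carrierᴹ 0ℓ
      isSubspace : IsSubspace Mem
    open IsSubspace isSubspace public

  infix 4 _∈_ _⊆_
  _∈_ : Carrierᴹ → Subspace → Set
  v ∈ y = Subspace.Mem y v

  _⊆_ : Subspace → Subspace → Set m
  y ⊆ z = ∀ v → v ∈ y → v ∈ z

  MeetTrivially : Subspace → Subspace → Set (m ⊔ ℓm)
  MeetTrivially y z = ∀ v → v ∈ y → v ∈ z → v ≈ᴹ 0ᴹ

  whole : Subspace
  whole = record
    { Mem        = λ _ → ⊤
    ; isSubspace = record
      { ∈? = λ _ → yes tt ; resp = λ _ _ → tt ; 0∈ = tt ; +∈ = λ _ _ → tt ; *∈ = λ _ _ → tt }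
    }

  lc : ∀ {d} → Vector Carrier d → Vector Carrierᴹ d → Carrierᴹ
  lc a b = sum (λ i → a i *ₗ b i)

  Spanned : ∀ {d} → Vector Carrierᴹ d → Pred Carrierᴹ (c ⊔ ℓm)
  Spanned b v = ∃ λ a → v ≈ᴹ lc a b

  Independent : ∀ {d} → Vector Carrierᴹ d → Set (c ⊔ ℓ ⊔ ℓm)
  Independent b = ∀ a → lc a b ≈ᴹ 0ᴹ → ∀ i → a i ≈ 0#

  record Basis (y : Subspace) (d : ℕ) : Set (c ⊔ ℓ ⊔ m ⊔ ℓm) where
    field
      vector      : Vector Carrierᴹ d
      vector∈     : ∀ i → vector i ∈ y
      independent : Independent vector
      spanning    : ∀ v → v ∈ y → Spanned vector v

  module _ where
    open Summation +ᴹ-commutativeMonoid using (sum-cong-≋; sum-replicate-zero; ∑-distrib-+)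
    open SetoidReasoning ≈ᴹ-setoid
    open GroupProperties +ᴹ-group using (∙-cancelʳ)

    lc-cong : ∀ {d} {a a′ : Vector Carrier d} (b : Vector Carrierᴹ d) →
              (∀ i → a i ≈ a′ i) → lc a b ≈ᴹ lc a′ b
    lc-cong b eq = sum-cong-≋ (λ i → *ₗ-congʳ (eq i))

    lc-zero : ∀ {d} {a : Vector Carrier d} (b : Vector Carrierᴹ d) →
              (∀ i → a i ≈ 0#) → lc a b ≈ᴹ 0ᴹ
    lc-zero {d} b eq = ≈ᴹ-trans
      (sum-cong-≋ (λ i → ≈ᴹ-trans (*ₗ-congʳ (eq i)) (*ₗ-zeroˡ (b i))))
      (sum-replicate-zero d)

    lc-+ : ∀ {d} (a a′ : Vector Carrier d) (b : Vector Carrierᴹ d) →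
           lc (λ i → a i + a′ i) b ≈ᴹ lc a b +ᴹ lc a′ b
    lc-+ a a′ b = ≈ᴹ-trans
      (sum-cong-≋ (λ i → *ₗ-distribʳ (b i) (a i) (a′ i)))
      (∑-distrib-+ (λ i → a i *ₗ b i) (λ i → a′ i *ₗ b i))

    lc-* : ∀ {d} s (a : Vector Carrier d) (b : Vector Carrierᴹ d) →
           lc (λ i → s * a i) b ≈ᴹ s *ₗ lc a b
    lc-* {zero}  s a b = ≈ᴹ-sym (*ₗ-zeroʳ s)
    lc-* {suc d} s a b = ≈ᴹ-trans
      (+ᴹ-cong (*ₗ-assoc s (a zero) (b zero)) (lc-* s (a ∘ suc) (b ∘ suc)))
      (≈ᴹ-sym (*ₗ-distribˡ s _ _))

    independent⇒unique : ∀ {d} {b : Vector Carrierᴹ d} → Independent b →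
                         ∀ a a′ → lc a b ≈ᴹ lc a′ b → ∀ i → a i ≈ a′ i
    independent⇒unique {b = b} ind a a′ eq i = x∙y⁻¹≈ε⇒x≈y (a i) (a′ i) (ind δ δ≈0 i)
      where
      open GroupProperties +-group using (x∙y⁻¹≈ε⇒x≈y)
      δ : Vector Carrier _
      δ i = a i + - a′ i
      δ≈0 : lc δ b ≈ᴹ 0ᴹ
      δ≈0 = ∙-cancelʳ (lc a′ b) (lc δ b) 0ᴹ (begin
        lc δ b +ᴹ lc a′ b           ≈⟨ lc-+ δ a′ b ⟨
        lc (λ i → δ i + a′ i) b     ≈⟨ lc-cong b (λ i → trans (+-assoc _ _ _)
                                         (trans (+-congˡ (-‿inverseˡ (a′ i))) (+-identityʳ _))) ⟩
        lc a b                      ≈⟨ eq ⟩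
        lc a′ b                     ≈⟨ +ᴹ-identityˡ _ ⟨
        0ᴹ +ᴹ lc a′ b               ∎)

    spanned-by-relation : ∀ {d} {b : Vector Carrierᴹ d} {v} s s⁻¹ a → s⁻¹ * s ≈ 1# →
                          s *ₗ v +ᴹ lc a b ≈ᴹ 0ᴹ → Spanned b v
    spanned-by-relation {b = b} {v} s s⁻¹ a inv eq = (λ i → - e i) ,
      ∙-cancelʳ (lc e b) v (lc (λ i → - e i) b) (begin
        v +ᴹ lc e b                        ≈⟨ +ᴹ-cong (≈ᴹ-sym unit) (lc-* s⁻¹ a b) ⟩
        s⁻¹ *ₗ s *ₗ v +ᴹ s⁻¹ *ₗ lc a b     ≈⟨ *ₗ-distribˡ s⁻¹ _ _ ⟨
        s⁻¹ *ₗ (s *ₗ v +ᴹ lc a b)          ≈⟨ *ₗ-congˡ eq ⟩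
        s⁻¹ *ₗ 0ᴹ                          ≈⟨ *ₗ-zeroʳ s⁻¹ ⟩
        0ᴹ                                 ≈⟨ lc-zero b (λ i → -‿inverseˡ (e i)) ⟨
        lc (λ i → - e i + e i) b           ≈⟨ lc-+ _ e b ⟩
        lc (λ i → - e i) b +ᴹ lc e b       ∎)
      where
      e : Vector Carrier _
      e i = s⁻¹ * a i
      unit : s⁻¹ *ₗ s *ₗ v ≈ᴹ v
      unit = ≈ᴹ-trans (≈ᴹ-sym (*ₗ-assoc s⁻¹ s v)) (≈ᴹ-trans (*ₗ-congʳ inv) (*ₗ-identityˡ v))

module FiniteLinearAlgebra
  {q : ℕ} {c ℓ m ℓm : Level} (F : FiniteField q c ℓ)
  (H : Module (FiniteField.commutativeRing F) m ℓm) where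

  open FiniteField F
  open Module H
  open LinearAlgebra commutativeRing H public
  private module 𝔽 = FiniteSetoid size

  1<q : 1 < q
  1<q = go q 𝔽.from (λ {x} {y} → 𝔽.from-injective {x} {y})
    where
    go : ∀ r (f : Carrier → Fin r) → (∀ {x y} → f x ≡ f y → x ≈ y) → 1 < r
    go zero          f inj = contradiction (f 0#) λ ()
    go (suc zero)    f inj = contradiction (inj (all-equal (f 1#) (f 0#))) 1≉0
      where
      all-equal : ∀ (i j : Fin 1) → i ≡ j
      all-equal zero zero = ≡.refl
    go (suc (suc r)) f inj = s≤s (s≤s z≤n)

  ^-reflects-≤ : ∀ k d → q ^ k ≤ q ^ d → k ≤ d
  ^-reflects-≤ k d le with k ℕₚ.≤? d
  ... | yes k≤d = k≤d
  ... | no  k≰d = contradiction le (ℕₚ.<⇒≱ (ℕₚ.^-monoʳ-< q 1<q (ℕₚ.≰⇒> k≰d)))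

  decodeᵥ : ∀ d → Fin (q ^ d) → Vector Carrier d
  decodeᵥ d i j = 𝔽.to (finToFun i j)

  encodeᵥ : ∀ d → Vector Carrier d → Fin (q ^ d)
  encodeᵥ d a = funToFin {d} {q} (λ j → 𝔽.from (a j))

  funToFin-cong : ∀ {k d} {f g : Fin k → Fin d} → f ≗ g → funToFin f ≡ funToFin g
  funToFin-cong {zero}  eq = ≡.refl
  funToFin-cong {suc k} eq = ≡.cong₂ combine (eq zero) (funToFin-cong (eq ∘ suc))

  decode-encode : ∀ {d} (a : Vector Carrier d) i → decodeᵥ d (encodeᵥ d a) i ≈ a i
  decode-encode {d} a i =
    trans (reflexive (≡.cong 𝔽.to (finToFun-funToFin {d} {q} (λ j → 𝔽.from (a j)) i))) (𝔽.to-from (a i))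

  encode-decode : ∀ d (i : Fin (q ^ d)) → encodeᵥ d (decodeᵥ d i) ≡ i
  encode-decode d i =
    ≡.trans (funToFin-cong {d} {q} (λ j → 𝔽.from-to (finToFun {q} {d} i j))) (funToFin-finToFin {d} {q} i)

  encode-cong : ∀ {d} {a a′ : Vector Carrier d} → (∀ i → a i ≈ a′ i) → encodeᵥ d a ≡ encodeᵥ d a′
  encode-cong {d} eq = funToFin-cong {d} {q} (λ j → 𝔽.from-cong (eq j))

  decode-reflects : ∀ d {i j : Fin (q ^ d)} → (∀ k → decodeᵥ d i k ≈ decodeᵥ d j k) → i ≡ j
  decode-reflects d {i} {j} eq =
    ≡.trans (≡.sym (encode-decode d i)) (≡.trans (encode-cong eq) (encode-decode d j))

  independent-bound : ∀ {k d} {u : Vector Carrierᴹ k} {b : Vector Carrierᴹ d} → Independent u →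
                      (∀ a → Spanned b (lc a u)) → k ≤ d
  independent-bound {k} {d} {u} {b} ind span = ^-reflects-≤ k d (injective⇒≤ f-injective)
    where
    coords : Fin (q ^ k) → Vector Carrier d
    coords i = proj₁ (span (decodeᵥ k i))
    f : Fin (q ^ k) → Fin (q ^ d)
    f i = encodeᵥ d (coords i)
    f-injective : ∀ {i j} → f i ≡ f j → i ≡ j
    f-injective {i} {j} eq = decode-reflects k (independent⇒unique ind (decodeᵥ k i) (decodeᵥ k j)
      (≈ᴹ-trans (proj₂ (span (decodeᵥ k i)))
      (≈ᴹ-trans (lc-cong b same)
                (≈ᴹ-sym (proj₂ (span (decodeᵥ k j)))))))
      where
      same : ∀ t → coords i t ≈ coords j t
      same t = trans (sym (decode-encode (coords i) t))
        (trans (reflexive (≡.cong (λ e → decodeᵥ d e t) eq)) (decode-encode (coords j) t))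

  lc∈ : ∀ (y : Subspace) {d} (a : Vector Carrier d) (b : Vector Carrierᴹ d) →
        (∀ i → b i ∈ y) → lc a b ∈ y
  lc∈ y {zero}  a b b∈ = Subspace.0∈ y
  lc∈ y {suc d} a b b∈ = Subspace.+∈ y (Subspace.*∈ y (a zero) (b∈ zero)) (lc∈ y (a ∘ suc) (b ∘ suc) (b∈ ∘ suc))

  basis-≤ : ∀ {y z k d} → y ⊆ z → Basis y k → Basis z d → k ≤ d
  basis-≤ {y} y⊆z B C = independent-bound (Basis.independent B)
    (λ a → Basis.spanning C _ (y⊆z _ (lc∈ y a (Basis.vector B) (Basis.vector∈ B))))

  module FiniteDimensional {n : ℕ} (dimH : Basis whole n) where

    private module Bᴴ = Basis dimH

    coord : Carrierᴹ → Vector Carrier n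
    coord v = proj₁ (Bᴴ.spanning v tt)

    lc-coord : ∀ v → v ≈ᴹ lc (coord v) Bᴴ.vector
    lc-coord v = proj₂ (Bᴴ.spanning v tt)

    coord-cong : ∀ {v w} → v ≈ᴹ w → ∀ i → coord v i ≈ coord w i
    coord-cong {v} {w} eq = independent⇒unique Bᴴ.independent (coord v) (coord w)
      (≈ᴹ-trans (≈ᴹ-sym (lc-coord v)) (≈ᴹ-trans eq (lc-coord w)))

    sizeᴴ : HasSize ≈ᴹ-setoid (q ^ n)
    sizeᴴ = record
      { to        = to
      ; from      = from
      ; to-cong   = λ { ≡.refl → ≈ᴹ-refl }
      ; from-cong = from-cong
      ; inverse   = (λ { {v} ≡.refl → to-from v })
                  , (λ {i} {v} eq → ≡.trans (from-cong eq) (from-to i))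
      }
      where
      to : Fin (q ^ n) → Carrierᴹ
      to i = lc (decodeᵥ n i) Bᴴ.vector
      from : Carrierᴹ → Fin (q ^ n)
      from v = encodeᵥ n (coord v)
      from-cong : ∀ {v w} → v ≈ᴹ w → from v ≡ from w
      from-cong eq = encode-cong (coord-cong eq)
      to-from : ∀ v → to (from v) ≈ᴹ v
      to-from v = ≈ᴹ-trans (lc-cong Bᴴ.vector (decode-encode (coord v))) (≈ᴹ-sym (lc-coord v))
      from-to : ∀ i → from (to i) ≡ i
      from-to i = decode-reflects n (λ k → trans (decode-encode (coord (to i)) k)
        (independent⇒unique Bᴴ.independent (coord (to i)) (decodeᵥ n i)
          (≈ᴹ-sym (lc-coord (to i))) k))

    module ℍ = FiniteSetoid sizeᴴ

    spanned-resp : ∀ {d} {b : Vector Carrierᴹ d} {v w} → v ≈ᴹ w → Spanned b v → Spanned b w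
    spanned-resp eq (a , p) = a , ≈ᴹ-trans (≈ᴹ-sym eq) p

    spanned? : ∀ {d} (b : Vector Carrierᴹ d) → Decidable (Spanned b)
    spanned? {d} b v = map′ (λ (i , p) → decodeᵥ d i , p)
      (λ (a , p) → encodeᵥ d a ,
         ≈ᴹ-trans p (≈ᴹ-sym (lc-cong b (decode-encode a))))
      (any? {n = q ^ d} (λ i → v ℍ.≟ lc (decodeᵥ d i) b))

    independent-∷ : ∀ {d} {b : Vector Carrierᴹ d} {v} → Independent b → ¬ Spanned b v →
                    Independent (v ∷ᵛ b)
    independent-∷ {b = b} {v} ind v∉ a eq = case
      where
      a₀≈0 : a zero ≈ 0#
      a₀≈0 = decidable-stable (a zero 𝔽.≟ 0#) λ a₀≉0 →
        let s⁻¹ , inv = inverse (a zero) a₀≉0 in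
        v∉ (spanned-by-relation (a zero) s⁻¹ (a ∘ suc) inv eq)
      case : ∀ i → a i ≈ 0#
      case zero    = a₀≈0
      case (suc i) = ind (a ∘ suc)
        (≈ᴹ-trans (≈ᴹ-sym (+ᴹ-identityˡ _))
        (≈ᴹ-trans (+ᴹ-congʳ (≈ᴹ-sym (≈ᴹ-trans (*ₗ-congʳ a₀≈0) (*ₗ-zeroˡ v)))) eq)) i

    extend : ∀ (y : Subspace) f {k} → k +ℕ f ≡ suc n → (b : Vector Carrierᴹ k) →
             (∀ i → b i ∈ y) → Independent b → ∃ (Basis y)
    extend y zero {k} k≡ b b∈ ind = contradiction
      (independent-bound ind (λ a → coord (lc a b) , lc-coord (lc a b)))
      (ℕₚ.<⇒≱ (ℕₚ.≤-reflexive (≡.trans (≡.sym k≡) (ℕₚ.+-identityʳ k))))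
    extend y (suc f) {k} k≡ b b∈ ind
      with ℍ.∃? {P = λ v → v ∈ y × ¬ Spanned b v}
             (λ { eq (p , r) → Subspace.resp y eq p , r ∘ spanned-resp (≈ᴹ-sym eq) })
             (λ v → Subspace.∈? y v ×-dec ¬? (spanned? b v))
    ... | yes (v , v∈ , v∉) = extend y f (≡.trans (≡.sym (ℕₚ.+-suc k f)) k≡) (v ∷ᵛ b)
            (λ { zero → v∈ ; (suc i) → b∈ i }) (independent-∷ ind v∉)
    ... | no  none = k , record
            { vector = b ; vector∈ = b∈ ; independent = ind
            ; spanning = λ v v∈ → decidable-stable (spanned? b v) (λ v∉ → none (v , v∈ , v∉)) }

    basis : ∀ y → ∃ (Basis y)
    basis y = extend y (suc n) {0} ≡.refl (λ ()) (λ ()) (λ _ _ ())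

    -- Any basis may be used here: see dim-unique and dim-cong below.
    dim : Subspace → ℕ
    dim y = proj₁ (basis y)

    dim-unique : ∀ {y d} → Basis y d → dim y ≡ d
    dim-unique {y} B = ℕₚ.≤-antisym
      (basis-≤ {y} {y} (λ _ p → p) (proj₂ (basis y)) B)
      (basis-≤ {y} {y} (λ _ p → p) B (proj₂ (basis y)))

    dim-cong : ∀ {y z} → y ⊆ z → z ⊆ y → dim y ≡ dim z
    dim-cong {y} {z} y⊆z z⊆y = ℕₚ.≤-antisym
      (basis-≤ {y} {z} y⊆z (proj₂ (basis y)) (proj₂ (basis z)))
      (basis-≤ {z} {y} z⊆y (proj₂ (basis z)) (proj₂ (basis y)))

    infix 4 _⊆?_
    _⊆?_ : ∀ y z → Dec (y ⊆ z)
    y ⊆? z = ℍ.∀? (λ eq f p → Subspace.resp z eq (f (Subspace.resp y (≈ᴹ-sym eq) p)))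
                  (λ v → Subspace.∈? y v →-dec Subspace.∈? z v)

    module AttenuatedSpace (h : Subspace) where

      X : Set (c ⊔ m ⊔ ℓm ⊔ lsuc 0ℓ)
      X = Σ Subspace (λ y → MeetTrivially y h)

      space : X → Subspace
      space = proj₁

      dimˣ : X → ℕ
      dimˣ y = dim (space y)

      X-setoid : Setoid (c ⊔ m ⊔ ℓm ⊔ lsuc 0ℓ) m
      X-setoid = record
        { Carrier       = X
        ; _≈_           = λ y z → space y ⊆ space z × space z ⊆ space y
        ; isEquivalence = record
          { refl  = (λ _ p → p) , (λ _ p → p)
          ; sym   = λ (p , r) → r , p
          ; trans = λ (p , r) (p′ , r′) → (λ v → p′ v ∘ p v) , (λ v → r v ∘ r′ v)
          }
        }

      -- z Covers y: z lies above y.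
      infix 4 _Covers_ _covers?_
      _Covers_ : X → X → Set m
      z Covers y = space y ⊆ space z × dimˣ z ≡ suc (dimˣ y)

      _covers?_ : ∀ z y → Dec (z Covers y)
      z covers? y = (space y ⊆? space z) ×-dec (dimˣ z ℕₚ.≟ suc (dimˣ y))

      -- Finiteness of X: run through all subsets of H, keep those that are
      -- subspaces meeting h trivially, and remove repetitions.

      Good : Pred Carrierᴹ 0ℓ → Set (c ⊔ m ⊔ ℓm)
      Good P = (P 0ᴹ × (∀ v w → P v → P w → P (v +ᴹ w)) × (∀ a v → P v → P (a *ₗ v)))
             × (∀ v → P v → v ∈ h → v ≈ᴹ 0ᴹ)

      good? : ∀ {P} → (∀ {v w} → v ≈ᴹ w → P v → P w) → Decidable P → Dec (Good P)
      good? {P} resp P? =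
        (P? 0ᴹ
        ×-dec ℍ.∀? (λ eq f w p r → resp (+ᴹ-congʳ eq) (f w (resp (≈ᴹ-sym eq) p) r))
                (λ v → ℍ.∀? (λ eq f p r → resp (+ᴹ-congˡ eq) (f p (resp (≈ᴹ-sym eq) r)))
                         (λ w → P? v →-dec (P? w →-dec P? (v +ᴹ w))))
        ×-dec 𝔽.∀? (λ eq f v p → resp (*ₗ-congʳ eq) (f v p))
                (λ a → ℍ.∀? (λ eq f p → resp (*ₗ-congˡ eq) (f (resp (≈ᴹ-sym eq) p)))
                         (λ v → P? v →-dec P? (a *ₗ v))))
        ×-dec ℍ.∀? (λ eq f p r → ≈ᴹ-trans (≈ᴹ-sym eq)
                      (f (resp (≈ᴹ-sym eq) p) (Subspace.resp h (≈ᴹ-sym eq) r)))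
                (λ v → P? v →-dec (Subspace.∈? h v →-dec v ℍ.≟ 0ᴹ))

      Coded : Fin (2 ^ (q ^ n)) → Pred Carrierᴹ 0ℓ
      Coded i v = finToFun i (ℍ.from v) ≡ suc zero

      coded-resp : ∀ i {v w} → v ≈ᴹ w → Coded i v → Coded i w
      coded-resp i eq p = ≡.trans (≡.cong (finToFun i) (≡.sym (ℍ.from-cong eq))) p

      coded? : ∀ i → Decidable (Coded i)
      coded? i v = finToFun i (ℍ.from v) Finₚ.≟ suc zero

      decode : Fin (2 ^ (q ^ n)) → Maybe X
      decode i with good? {Coded i} (coded-resp i) (coded? i)
      ... | no _ = nothing
      ... | yes ((z , p , s) , t) = just
        (record { Mem = Coded i ; isSubspace = record
          { ∈? = coded? i ; resp = coded-resp i ; 0∈ = z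
          ; +∈ = λ {v} {w} → p v w ; *∈ = λ a {v} → s a v } } , t)

      code : X → Fin (2 ^ (q ^ n))
      code (y , _) = funToFin (λ j → if does (Subspace.∈? y (ℍ.to j)) then suc zero else zero)

      code-correct : ∀ y v → (Coded (code y) v → v ∈ space y) × (v ∈ space y → Coded (code y) v)
      code-correct x@(y , _) v = fwd , bwd
        where
        bit : Fin (q ^ n) → Fin 2
        bit j = if does (Subspace.∈? y (ℍ.to j)) then suc zero else zero
        β : finToFun (code x) (ℍ.from v) ≡ bit (ℍ.from v)
        β = finToFun-funToFin bit (ℍ.from v)
        bit⇒ : ∀ j → bit j ≡ suc zero → ℍ.to j ∈ y
        bit⇒ j eq with Subspace.∈? y (ℍ.to j)
        bit⇒ j eq | yes p = p
        bit⇒ j () | no _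
        ⇒bit : ∀ j → ℍ.to j ∈ y → bit j ≡ suc zero
        ⇒bit j p with Subspace.∈? y (ℍ.to j)
        ... | yes _ = ≡.refl
        ... | no ¬p = contradiction p ¬p
        fwd : Coded (code x) v → v ∈ y
        fwd p = Subspace.resp y (ℍ.to-from v) (bit⇒ (ℍ.from v) (≡.trans (≡.sym β) p))
        bwd : v ∈ y → Coded (code x) v
        bwd p = ≡.trans β (⇒bit (ℍ.from v) (Subspace.resp y (≈ᴹ-sym (ℍ.to-from v)) p))

      decode-code : ∀ y → MaybeAny (Setoid._≈_ X-setoid y) (decode (code y))
      decode-code y with good? {Coded (code y)} (coded-resp (code y)) (coded? (code y))
      ... | yes _ = just′ ((λ v → proj₂ (code-correct y v)) , (λ v → proj₁ (code-correct y v)))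
      ... | no ¬g = contradiction good ¬g
        where
        open Subspace (space y)
        in-y : ∀ {v} → Coded (code y) v → v ∈ space y
        in-y {v} = proj₁ (code-correct y v)
        out-y : ∀ {v} → v ∈ space y → Coded (code y) v
        out-y {v} = proj₂ (code-correct y v)
        good : Good (Coded (code y))
        good = ( out-y 0∈
               , (λ v w p r → out-y (+∈ (in-y p) (in-y r)))
               , (λ a v p → out-y (*∈ a (in-y p))) )
             , (λ v p r → proj₂ y v (in-y p) r)

      infix 4 _≟ˣ_
      _≟ˣ_ : ∀ y z → Dec (Setoid._≈_ X-setoid y z)
      y ≟ˣ z = (space y ⊆? space z) ×-dec (space z ⊆? space y)

      X-decSetoid : DecSetoid (c ⊔ m ⊔ ℓm ⊔ lsuc 0ℓ) m
      X-decSetoid = record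
        { Carrier          = X
        ; _≈_              = Setoid._≈_ X-setoid
        ; isDecEquivalence = record
          { isEquivalence = Setoid.isEquivalence X-setoid
          ; _≟_           = _≟ˣ_
          }
        }

      elements : List X
      elements = deduplicate _≟ˣ_ (mapMaybe decode (allFin _))

      elements-unique : Uniq.Unique X-setoid elements
      elements-unique = DecUniqₚ.deduplicate-! X-decSetoid (mapMaybe decode (allFin _))

      elements-enumerate : IsEnumeration X-setoid elements
      elements-enumerate y =
        Memₚ.∈-deduplicate⁺ X-setoid _≟ˣ_
          (λ {a} {b} {d} e f → Setoid.trans X-setoid {a} {b} {d} f (Setoid.sym X-setoid {d} {b} e))
          {z = y}
          (Anyₚ.mapMaybe⁺ decode (allFin _)
            (Anyₚ.map⁺ (Any.map (λ { ≡.refl → decode-code y }) (∈-allFin (code y)))))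

      sizeˣ : HasSize X-setoid (length elements)
      sizeˣ = enumeration⇒size X-setoid elements elements-enumerate elements-unique

      -- The entries only involve 0, 1 and powers of q and q⁻¹, so K can be any
      -- commutative ring in which q is invertible, such as the complex numbers.
      module AttenuatedMatrices
        {k ℓk : Level} (K : CommutativeRing k ℓk) (q-inv : InvertibleIn K q) where

        private module K = CommutativeRing K
        open Exponentiation K.semiring using () renaming (_^_ to _^ᴷ_) public
        open Matrices sizeˣ K public

        qᴷ q⁻¹ : K.Carrier
        qᴷ  = fromℕ K q
        q⁻¹ = proj₁ q-inv

        A : Mat
        A y z =
          if does (y covers? z) then K.1#
          else if does (z covers? y) then qᴷ ^ᴷ dimˣ y
          else K.0#

        A* : Mat
        A* y z = if does (y ≟ˣ z) then q⁻¹ ^ᴷ dimˣ y else K.0#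

{-# OPTIONS --safe #-}
module Submission where

open import Defs
open import Level using (Level; _⊔_)
open import Data.Nat.Base as ℕ using (ℕ; zero; suc; NonZero; _∸_; _≤_; _<_; s≤s; z≤n) renaming (_+_ to _+ℕ_)
import Data.Nat.Properties as ℕₚ
open import Data.Nat.Solver using (module +-*-Solver)
open import Data.Integer.Base as ℤ using (ℤ; +_; -[1+_]; _⊖_)
import Data.Integer.Properties as ℤₚ
import Data.Sign.Base as Sign
open import Data.Fin.Base using (Fin; zero; suc)
import Data.Fin.Properties as Finₚ
open import Data.Bool.Base using (if_then_else_)
import Data.Maybe.Base as Maybe
open import Data.Product.Base using (∃; _×_; _,_; proj₁; proj₂)
open import Data.Unit.Base using (tt)
open import Data.Vec.Functional using () renaming (_∷_ to _∷ᵛ_)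
open import Function.Base using (_∘_; id)
open import Function.Construct.Identity using () renaming (inverse to id-inverse)
open import Relation.Binary.Bundles using (Setoid)
open import Relation.Binary.Consequences using (dec⇒weaklyDec)
open import Relation.Binary.Definitions using (WeaklyDecidable)
open import Relation.Binary.PropositionalEquality as ≡ using (_≡_; cong; cong₂; module ≡-Reasoning)
open import Relation.Nullary using (¬_; Dec; yes; no; does; contradiction)
open import Relation.Nullary.Decidable using (_×-dec_; ¬?; True; T?; ⌊_⌋; toWitness; fromWitness; decidable-stable)
open import Algebra.Bundles using (CommutativeMonoid; CommutativeRing; Semiring)
open import Algebra.Module.Bundles using (Module)
import Algebra.Properties.AbelianGroup as AbelianGroupProperties
import Algebra.Properties.CommutativeMonoid.Sum as Summation
import Algebra.Properties.CommutativeSemigroup as CommutativeSemigroupProperties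
import Algebra.Properties.Group as GroupProperties
import Algebra.Properties.Ring as RingProperties
import Algebra.Properties.Semiring.Exp as Exponentiation
import Algebra.Properties.Semiring.Mult as SemiringMultiples
import Algebra.Properties.Semiring.Mult.TCOptimised as Multiples′
import Algebra.Properties.Semiring.Sum as SemiringSum
import Algebra.Solver.Ring as RingSolver
import Algebra.Solver.Ring.AlmostCommutativeRing as ACR
import Relation.Binary.Reasoning.Setoid as SetoidReasoning

-- Write u(y,z) = 1 if y covers z and 0 otherwise, θ = q^(−dim), φ = q^dim, so
-- A(y,z) = u(y,z) + φ(y) u(z,y). The first relation says that A commutes with
-- A²A* − βAA*A + A*A² − q^(N+M−2)(q+1)²A*. In A²A* − βAA*A + A*A² two steps in
-- the same direction cancel, and what is left is a multiple of the symmetric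
-- matrix UᵀU − q UUᵀ with U = (u(y,z)). The relation thus becomes the counting
-- identity
--   (q+1) UUᵀU − q UUUᵀ − UᵀUU = (q+1) q^(N+M−dim y) U
-- (row y). Because q+1 elements lie strictly between the ends of an interval of
-- rank 2, q+1 can be cancelled. The remaining identity follows by counting the
-- covers of z inside a subspace b ⊇ z: there are |b \ (z + h)| / (q^(dim z + 1) − q^(dim z))
-- of them.

-- Sums over finite setoids and counting

-- The obstacle is `h`: leaving out the subspaces that meet it breaks the uniform counts of the full
-- subspace lattice. The counting identity survives because every loss occurs twice. Suppose z is
-- not below y and b = y + z lies one dimension above y and two above z. If b meets h, then b itself
-- disappears as a common upper bound, and so does exactly one of the q + 1 subspaces between z and
-- b. If y covers z, the numbers of covers of y and of z both involve |h|, but as the same additive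
-- constant in covers(a)(q - 1) + |h| = q^(N+M-dim a), so their difference does not see it. The
-- counting stays in ℕ, with each subtraction moved to the other side, and reaches `K` only through
-- `fromℕ`. The remaining part of the commutator is -φ times the transpose of the part in the
-- identity, so one identity serves both.

module _ {c ℓ : Level} (M : CommutativeMonoid c ℓ) where
  open CommutativeMonoid M
  open Summation M using (sum; sum-cong-≋; sum-replicate-zero)

  sum-zero : ∀ {n} (f : Fin n → Carrier) → (∀ i → f i ≈ ε) → sum f ≈ ε
  sum-zero {n} f f≈ε = trans (sum-cong-≋ f≈ε) (sum-replicate-zero n)

  sum-single : ∀ {n} (f : Fin n → Carrier) i → (∀ j → ¬ j ≡ i → f j ≈ ε) → sum f ≈ f i
  sum-single f zero    off = trans (∙-congˡ (sum-zero (f ∘ suc) (λ j → off (suc j) λ ()))) (identityʳ _)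
  sum-single f (suc i) off = trans
    (∙-cong (off zero λ ()) (sum-single (f ∘ suc) i (λ j j≢i → off (suc j) (j≢i ∘ Finₚ.suc-injective))))
    (identityˡ _)

module FiniteSum
  {a ℓ c ℓ′ : Level} {S : Setoid a ℓ} {n : ℕ} (size : HasSize S n) (R : Semiring c ℓ′) where

  open Setoid S using () renaming (Carrier to I; _≈_ to _≈ᴵ_; sym to symᴵ)
  open Semiring R hiding (zero)
  open SemiringSum R using (sum; sum-cong-≋; ∑-distrib-+; *-distribˡ-sum; *-distribʳ-sum)
  open FiniteSetoid size using (to; from; to-from; from-to; from-cong)

  ∑ : (I → Carrier) → Carrier
  ∑ f = sum (λ i → f (to i))

  ∑-cong : ∀ {f g} → (∀ x → f x ≈ g x) → ∑ f ≈ ∑ g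
  ∑-cong f≈g = sum-cong-≋ (λ i → f≈g (to i))

  ∑-zero : ∀ {f} → (∀ x → f x ≈ 0#) → ∑ f ≈ 0#
  ∑-zero f≈0 = sum-zero +-commutativeMonoid _ (λ i → f≈0 (to i))

  ∑-+ : ∀ f g → ∑ (λ x → f x + g x) ≈ ∑ f + ∑ g
  ∑-+ f g = ∑-distrib-+ (λ i → f (to i)) (λ i → g (to i))

  ∑-*ˡ : ∀ s f → ∑ (λ x → s * f x) ≈ s * ∑ f
  ∑-*ˡ s f = sym (*-distribˡ-sum s (λ i → f (to i)))

  ∑-*ʳ : ∀ s f → ∑ (λ x → f x * s) ≈ ∑ f * s
  ∑-*ʳ s f = sym (*-distribʳ-sum s (λ i → f (to i)))

  ∑-single : ∀ {f v} x → (∀ y → y ≈ᴵ x → f y ≈ v) → (∀ y → ¬ y ≈ᴵ x → f y ≈ 0#) → ∑ f ≈ v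
  ∑-single {f} x on off = trans
    (sum-single +-commutativeMonoid (λ i → f (to i)) (from x)
      (λ j j≢ → off (to j) (λ eq → j≢ (≡.trans (≡.sym (from-to j)) (from-cong eq)))))
    (on (to (from x)) (to-from x))

module _
  {a ℓ a′ ℓ′ c ℓ″ : Level} {S : Setoid a ℓ} {T : Setoid a′ ℓ′} {n k : ℕ}
  (sizeˢ : HasSize S n) (sizeᵗ : HasSize T k) (R : Semiring c ℓ″) where

  open Semiring R using (_≈_) renaming (Carrier to A)
  private
    module Sₛ = FiniteSum sizeˢ R
    module Tₛ = FiniteSum sizeᵗ R

  ∑-swap : ∀ (f : Setoid.Carrier S → Setoid.Carrier T → A) → Sₛ.∑ (λ x → Tₛ.∑ (f x)) ≈ Tₛ.∑ (λ y → Sₛ.∑ (λ x → f x y))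
  ∑-swap f = SemiringSum.∑-comm R {n} {k}
    (λ i j → f (FiniteSetoid.to sizeˢ i) (FiniteSetoid.to sizeᵗ j))

ind : ∀ {p} {P : Set p} → Dec P → ℕ
ind P? = if does P? then 1 else 0

ind-yes : ∀ {p} {P : Set p} (P? : Dec P) → P → ind P? ≡ 1
ind-yes (yes _) p = ≡.refl
ind-yes (no ¬p) p = contradiction p ¬p

ind-no : ∀ {p} {P : Set p} (P? : Dec P) → ¬ P → ind P? ≡ 0
ind-no (yes p) ¬p = contradiction p ¬p
ind-no (no _)  ¬p = ≡.refl

ind-cong : ∀ {p r} {P : Set p} {Q : Set r} (P? : Dec P) (Q? : Dec Q) →
           (P → Q) → (Q → P) → ind P? ≡ ind Q?
ind-cong (yes p) Q? f g = ≡.sym (ind-yes Q? (f p))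
ind-cong (no ¬p) Q? f g = ≡.sym (ind-no Q? (¬p ∘ g))

ind-× : ∀ {p r} {P : Set p} {Q : Set r} (P? : Dec P) (Q? : Dec Q) →
        ind P? ℕ.* ind Q? ≡ ind (P? ×-dec Q?)
ind-× (yes _) (yes _) = ≡.refl
ind-× (yes _) (no _)  = ≡.refl
ind-× (no _)  _       = ≡.refl

-- Lets the second factor of a summand be computed under the condition that the first factor tests.
ind-*-cong : ∀ {p} {P : Set p} (P? : Dec P) {x y} → (P → x ≡ y) → ind P? ℕ.* x ≡ ind P? ℕ.* y
ind-*-cong (yes p) eq = ≡.cong (1 ℕ.*_) (eq p)
ind-*-cong (no _)  eq = ≡.refl

module Counting {a ℓ : Level} {S : Setoid a ℓ} {n : ℕ} (size : HasSize S n) where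

  open Setoid S using (_≈_; sym; trans) renaming (Carrier to I)
  open FiniteSum size ℕₚ.+-*-semiring public

  module _ {p : Level} {P : I → Set p} (P? : ∀ x → Dec (P x)) where

    count-none : (∀ x → ¬ P x) → ∑ (λ x → ind (P? x)) ≡ 0
    count-none none = ∑-zero (λ x → ind-no (P? x) (none x))

    count-unique : (∀ {x y} → x ≈ y → P x → P y) → ∀ x → P x → (∀ y → P y → y ≈ x) →
                   ∑ (λ y → ind (P? y)) ≡ 1
    count-unique resp x px unique = ∑-single x
      (λ y y≈x → ind-yes (P? y) (resp (sym y≈x) px))
      (λ y y≉x → ind-no (P? y) (y≉x ∘ unique y))

    -- Turns a condition with an essentially unique witness into a sum over candidates, so that it
    -- can take part in a double count. `resp` is there because the sum may visit another
    -- representative than the given witness.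
    count-witness : ∀ {r} {R : Set r} (R? : Dec R) → (∀ {x y} → x ≈ y → P x → P y) →
                    (∀ x → P x → R) → (R → ∃ λ x → P x × (∀ y → P y → y ≈ x)) →
                    ∑ (λ x → ind (P? x)) ≡ ind R?
    count-witness (yes r) resp _ witness = let x , px , unique = witness r in count-unique resp x px unique
    count-witness (no ¬r) _ sound _      = count-none (λ x px → ¬r (sound x px))

-- Subspaces of a finite vector space

module SubspaceGeometry
  {q n : ℕ} {c ℓ m ℓm : Level} (F : FiniteField q c ℓ)
  (H : Module (FiniteField.commutativeRing F) m ℓm)
  (dimH : FiniteLinearAlgebra.Basis F H (FiniteLinearAlgebra.whole F H) n) where

  open FiniteField F hiding (inverse) public
  open Module H public
  open FiniteLinearAlgebra F H public
  open FiniteDimensional dimH public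
  private module 𝔽 = FiniteSetoid size

  open Subspace using (∈?; resp; 0∈; +∈; *∈)

  cancel-multiple : ∀ s x v → (x +ᴹ s *ₗ v) +ᴹ (- s) *ₗ v ≈ᴹ x
  cancel-multiple s x v =
    ≈ᴹ-trans (+ᴹ-assoc _ _ _)
    (≈ᴹ-trans (+ᴹ-congˡ (≈ᴹ-trans (≈ᴹ-sym (*ₗ-distribʳ v s (- s)))
                        (≈ᴹ-trans (*ₗ-congʳ (-‿inverseʳ s)) (*ₗ-zeroˡ v))))
              (+ᴹ-identityʳ x))

  cancel-negative : ∀ v → v +ᴹ (- 1#) *ₗ v ≈ᴹ 0ᴹ
  cancel-negative v =
    ≈ᴹ-trans (+ᴹ-congʳ (≈ᴹ-sym (*ₗ-identityˡ v)))
    (≈ᴹ-trans (≈ᴹ-sym (*ₗ-distribʳ v 1# (- 1#)))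
    (≈ᴹ-trans (*ₗ-congʳ (-‿inverseʳ 1#)) (*ₗ-zeroˡ v)))

  ∈-remove-multiple : ∀ (y : Subspace) s {x v} → x +ᴹ s *ₗ v ∈ y → v ∈ y → x ∈ y
  ∈-remove-multiple y s {x} {v} p v∈ = resp y (cancel-multiple s x v) (+∈ y p (*∈ y (- s) v∈))

  ∈-remove : ∀ (y : Subspace) {x v} → x +ᴹ v ∈ y → v ∈ y → x ∈ y
  ∈-remove y {x} {v} p v∈ = ∈-remove-multiple y 1# (resp y (+ᴹ-congˡ (≈ᴹ-sym (*ₗ-identityˡ v))) p) v∈

  opaque
    line? : ∀ (a : Subspace) v x → Dec (∃ λ s → x +ᴹ s *ₗ v ∈ a)
    line? a v x = 𝔽.∃? (λ eq → resp a (+ᴹ-congˡ (*ₗ-congʳ eq))) (λ s → ∈? a (x +ᴹ s *ₗ v))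

  -- 'True' places membership in the level that 'Subspace' requires.
  infixl 7 _⊕⟨_⟩
  _⊕⟨_⟩ : Subspace → Carrierᴹ → Subspace
  a ⊕⟨ v ⟩ = record
    { Mem        = λ x → True (line? a v x)
    ; isSubspace = record
      { ∈?   = λ x → T? ⌊ line? a v x ⌋
      ; resp = λ eq p → let s , r = toWitness p in
          fromWitness (s , resp a (+ᴹ-congʳ eq) r)
      ; 0∈   = fromWitness (0# , resp a (≈ᴹ-sym (≈ᴹ-trans (+ᴹ-identityˡ _) (*ₗ-zeroˡ v))) (0∈ a))
      ; +∈   = λ p p′ → let s , r = toWitness p ; s′ , r′ = toWitness p′ in
          fromWitness (s + s′ , resp a (interchange s s′) (+∈ a r r′))
      ; *∈   = λ t p → let s , r = toWitness p in
          fromWitness (t * s , resp a (≈ᴹ-trans (*ₗ-distribˡ t _ _) (+ᴹ-congˡ (≈ᴹ-sym (*ₗ-assoc t s v)))) (*∈ a t r))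
      }
    }
    where
    interchange : ∀ {x x′} s s′ → (x +ᴹ s *ₗ v) +ᴹ (x′ +ᴹ s′ *ₗ v) ≈ᴹ (x +ᴹ x′) +ᴹ (s + s′) *ₗ v
    interchange s s′ = ≈ᴹ-trans (medial _ _ _ _) (+ᴹ-congˡ (≈ᴹ-sym (*ₗ-distribʳ v s s′)))
      where
      open CommutativeSemigroupProperties (CommutativeMonoid.commutativeSemigroup +ᴹ-commutativeMonoid) using () renaming (interchange to medial)

  ⊕-elim : ∀ {a v x} → x ∈ a ⊕⟨ v ⟩ → ∃ λ s → x +ᴹ s *ₗ v ∈ a
  ⊕-elim {a} {v} {x} = toWitness {a? = line? a v x}

  ⊕-intro : ∀ {a v x} s → x +ᴹ s *ₗ v ∈ a → x ∈ a ⊕⟨ v ⟩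
  ⊕-intro {a} {v} {x} s p = fromWitness {a? = line? a v x} (s , p)

  ⊕-base : ∀ {a v} → a ⊆ a ⊕⟨ v ⟩
  ⊕-base {a} {v} x p = ⊕-intro {a} 0# (resp a (≈ᴹ-sym (≈ᴹ-trans (+ᴹ-congˡ (*ₗ-zeroˡ v)) (+ᴹ-identityʳ x))) p)

  ⊕-direction : ∀ {a v} → v ∈ a ⊕⟨ v ⟩
  ⊕-direction {a} {v} = ⊕-intro {a} (- 1#) (resp a (≈ᴹ-sym (cancel-negative v)) (0∈ a))

  ⊕-least : ∀ {a b v} → a ⊆ b → v ∈ b → a ⊕⟨ v ⟩ ⊆ b
  ⊕-least {a} {b} {v} a⊆b v∈ x p = let s , r = ⊕-elim {a} p in ∈-remove-multiple b s (a⊆b _ r) v∈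

  dim-mono : ∀ {a b} → a ⊆ b → dim a ≤ dim b
  dim-mono {a} {b} a⊆b = basis-≤ {a} {b} a⊆b (proj₂ (basis a)) (proj₂ (basis b))

  dim-bound : ∀ a → dim a ≤ n
  dim-bound a = basis-≤ {a} {whole} (λ _ _ → tt) (proj₂ (basis a)) dimH

  dim-⊕ : ∀ {a v} → ¬ v ∈ a → dim (a ⊕⟨ v ⟩) ≡ suc (dim a)
  dim-⊕ {a} {v} v∉ = dim-unique {a ⊕⟨ v ⟩} record
    { vector      = v ∷ᵛ B.vector
    ; vector∈     = λ { zero → ⊕-direction {a} ; (suc i) → ⊕-base {a} _ (B.vector∈ i) }
    ; independent = independent-∷ B.independent
        (λ (s , eq) → v∉ (resp a (≈ᴹ-sym eq) (lc∈ a s B.vector B.vector∈)))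
    -- Here x + s v lies in a, so the coefficient of v in x is -s.
    ; spanning    = λ x p → let s , r = ⊕-elim {a} p ; e , eq = B.spanning _ r in
        (- s) ∷ᵛ e ,
        ≈ᴹ-trans (≈ᴹ-sym (cancel-multiple s x v)) (≈ᴹ-trans (+ᴹ-comm _ _) (+ᴹ-congˡ eq))
    }
    where module B = Basis (proj₂ (basis a))

  -- A vector of b outside a would give a subspace of b of dimension dim a + 1.
  ⊆-antisym-dim : ∀ {a b} → a ⊆ b → dim b ≤ dim a → b ⊆ a
  ⊆-antisym-dim {a} {b} a⊆b le v v∈b = decidable-stable (∈? a v) λ v∉a →
    ℕₚ.<-irrefl ≡.refl (ℕₚ.≤-trans (ℕₚ.≤-reflexive (≡.sym (dim-⊕ {a} v∉a)))
      (ℕₚ.≤-trans (dim-mono {a ⊕⟨ v ⟩} {b} (⊕-least {a} {b} a⊆b v∈b)) le))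

  hyperplane-⊕ : ∀ {a b v} → a ⊆ b → dim b ≡ suc (dim a) → v ∈ b → ¬ v ∈ a → b ⊆ a ⊕⟨ v ⟩
  hyperplane-⊕ {a} {b} {v} a⊆b d v∈b v∉a = ⊆-antisym-dim {a ⊕⟨ v ⟩} {b}
    (⊕-least {a} {b} a⊆b v∈b) (ℕₚ.≤-reflexive (≡.trans d (≡.sym (dim-⊕ {a} v∉a))))

  outside? : ∀ a b → Dec (∃ λ v → v ∈ b × ¬ v ∈ a)
  outside? a b = ℍ.∃? (λ eq (p , r) → resp b eq p , r ∘ resp a (≈ᴹ-sym eq))
                      (λ v → ∈? b v ×-dec ¬? (∈? a v))

  ⊈⇒outside : ∀ {a b} → ¬ b ⊆ a → ∃ λ v → v ∈ b × ¬ v ∈ a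
  ⊈⇒outside {a} {b} b⊈a = decidable-stable (outside? a b) λ none →
    b⊈a (λ v v∈b → decidable-stable (∈? a v) (λ v∉a → none (v , v∈b , v∉a)))

  infixl 7 _∩_
  _∩_ : Subspace → Subspace → Subspace
  a ∩ b = record
    { Mem        = λ v → v ∈ a × v ∈ b
    ; isSubspace = record
      { ∈?   = λ v → ∈? a v ×-dec ∈? b v
      ; resp = λ eq (p , r) → resp a eq p , resp b eq r
      ; 0∈   = 0∈ a , 0∈ b
      ; +∈   = λ (p , r) (p′ , r′) → +∈ a p p′ , +∈ b r r′
      ; *∈   = λ t (p , r) → *∈ a t p , *∈ b t r
      }
    }

  -- Take v in e outside a. As b = a ⊕ ⟨v⟩, every x in e has some x + s v in a, and this sum stays
  -- in e; hence e = (e ∩ a) ⊕ ⟨v⟩.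
  dim-∩-hyperplane : ∀ {a b e} → a ⊆ b → dim b ≡ suc (dim a) → e ⊆ b → ¬ e ⊆ a →
                     dim e ≡ suc (dim (e ∩ a))
  dim-∩-hyperplane {a} {b} {e} a⊆b d e⊆b e⊈a =
    let v , v∈e , v∉a = ⊈⇒outside {a} {e} e⊈a
        e⊆ : e ⊆ (e ∩ a) ⊕⟨ v ⟩
        e⊆ x x∈e = let s , r = ⊕-elim {a} (hyperplane-⊕ {a} {b} a⊆b d (e⊆b v v∈e) v∉a x (e⊆b x x∈e)) in
          ⊕-intro {e ∩ a} s (+∈ e x∈e (*∈ e s v∈e) , r)
    in ≡.trans
      (dim-cong {e} {(e ∩ a) ⊕⟨ v ⟩} e⊆ (⊕-least {e ∩ a} {e} (λ _ → proj₁) v∈e))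
      (dim-⊕ {e ∩ a} (v∉a ∘ proj₂))

  -- Numbers of vectors in subspaces, translates and sums

  open module ∑ᴴ = Counting sizeᴴ public using () renaming (∑ to ∑ᴴ)

  private
    sizeᶠⁱⁿ : ∀ k → HasSize (≡.setoid (Fin k)) k
    sizeᶠⁱⁿ k = id-inverse (≡.setoid (Fin k))

  card : Subspace → ℕ
  card a = ∑ᴴ (λ v → ind (∈? a v))

  -- Membership of v is spread over the codes of coordinate vectors for a basis of a. Exchanging the
  -- sums then counts codes, as each code names a single vector.
  card≡q^dim : ∀ a → card a ≡ q ℕ.^ dim a
  card≡q^dim a = begin
    ∑ᴴ (λ v → ind (∈? a v))                          ≡⟨ ∑ᴴ.∑-cong coordinates ⟩
    ∑ᴴ (λ v → ∑ᶠ (λ i → ind (v ℍ.≟ point i)))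
      ≡⟨ ∑-swap sizeᴴ (sizeᶠⁱⁿ _) ℕₚ.+-*-semiring (λ v i → ind (v ℍ.≟ point i)) ⟩
    ∑ᶠ (λ i → ∑ᴴ (λ v → ind (v ℍ.≟ point i)))
      ≡⟨ Fₛ.∑-cong (λ i → ∑ᴴ.count-unique (λ v → v ℍ.≟ point i)
         (λ eq p → ≈ᴹ-trans (≈ᴹ-sym eq) p) (point i) ≈ᴹ-refl (λ _ p → p)) ⟩
    ∑ᶠ (λ _ → 1)                                     ≡⟨ ones (q ℕ.^ dim a) ⟩
    q ℕ.^ dim a                                      ∎
    where
    open ≡-Reasoning
    module B = Basis (proj₂ (basis a))
    module Fₛ = Counting (sizeᶠⁱⁿ (q ℕ.^ dim a))
    open Fₛ using () renaming (∑ to ∑ᶠ)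
    point : Fin (q ℕ.^ dim a) → Carrierᴹ
    point i = lc (decodeᵥ (dim a) i) B.vector
    ones : ∀ k → Counting.∑ (sizeᶠⁱⁿ k) (λ _ → 1) ≡ k
    ones zero    = ≡.refl
    ones (suc k) = cong suc (ones k)
    coordinates : ∀ v → ind (∈? a v) ≡ ∑ᶠ (λ i → ind (v ℍ.≟ point i))
    coordinates v = ≡.sym (Fₛ.count-witness (λ i → v ℍ.≟ point i) (∈? a v) (λ { ≡.refl p → p })
      (λ i eq → resp a (≈ᴹ-sym eq) (lc∈ a (decodeᵥ (dim a) i) B.vector B.vector∈))
      (λ v∈ → let s , eq = B.spanning v v∈
                  eq′ = ≈ᴹ-trans eq (≈ᴹ-sym (lc-cong B.vector (decode-encode s)))
              in encodeᵥ (dim a) s , eq′ , λ j p → decode-reflects (dim a)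
                   (independent⇒unique B.independent _ _ (≈ᴹ-trans (≈ᴹ-sym p) eq′))))

  infix 4 _∈+_,_
  -- Membership in a + h. The sign of the component in h is immaterial, and for fixed x the
  -- condition v + x ∈ a describes a translate of a.
  _∈+_,_ : Carrierᴹ → Subspace → Subspace → Set m
  v ∈+ a , h = ∃ λ x → x ∈ h × v +ᴹ x ∈ a

  opaque
    ∈+? : ∀ a h v → Dec (v ∈+ a , h)
    ∈+? a h v = ℍ.∃? (λ eq (p , r) → resp h eq p , resp a (+ᴹ-congˡ eq) r)
                     (λ x → ∈? h x ×-dec ∈? a (v +ᴹ x))

  -- Double count of the pairs (v, w) with w = v + x and w in a: w has the single preimage w - x.
  card-translate : ∀ a x → ∑ᴴ (λ v → ind (∈? a (v +ᴹ x))) ≡ card a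
  card-translate a x = begin
    ∑ᴴ (λ v → ind (∈? a (v +ᴹ x)))                                  ≡⟨ ∑ᴴ.∑-cong substitute ⟩
    ∑ᴴ (λ v → ∑ᴴ (λ w → ind (w ℍ.≟ v +ᴹ x) ℕ.* ind (∈? a w)))
      ≡⟨ ∑-swap sizeᴴ sizeᴴ ℕₚ.+-*-semiring (λ v w → ind (w ℍ.≟ v +ᴹ x) ℕ.* ind (∈? a w)) ⟩
    ∑ᴴ (λ w → ∑ᴴ (λ v → ind (w ℍ.≟ v +ᴹ x) ℕ.* ind (∈? a w)))
      ≡⟨ ∑ᴴ.∑-cong (λ w → ≡.trans (∑ᴴ.∑-*ʳ (ind (∈? a w)) (λ v → ind (w ℍ.≟ v +ᴹ x)))
         (≡.trans (cong (ℕ._* ind (∈? a w)) (solution w)) (ℕₚ.*-identityˡ _))) ⟩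
    ∑ᴴ (λ w → ind (∈? a w))                                         ∎
    where
    open ≡-Reasoning
    substitute : ∀ v → ind (∈? a (v +ᴹ x)) ≡ ∑ᴴ (λ w → ind (w ℍ.≟ v +ᴹ x) ℕ.* ind (∈? a w))
    substitute v = ≡.sym (≡.trans
      (∑ᴴ.∑-cong (λ w → ≡.trans
        (ind-*-cong (w ℍ.≟ v +ᴹ x) (λ eq → ind-cong (∈? a w) (∈? a (v +ᴹ x)) (resp a eq) (resp a (≈ᴹ-sym eq))))
        ≡.refl))
      (≡.trans (∑ᴴ.∑-*ʳ (ind (∈? a (v +ᴹ x))) (λ w → ind (w ℍ.≟ v +ᴹ x)))
      (≡.trans (cong (ℕ._* ind (∈? a (v +ᴹ x)))
        (∑ᴴ.count-unique (λ w → w ℍ.≟ v +ᴹ x) (λ eq p → ≈ᴹ-trans (≈ᴹ-sym eq) p) (v +ᴹ x) ≈ᴹ-refl (λ _ p → p)))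
        (ℕₚ.*-identityˡ _))))
    solution : ∀ w → ∑ᴴ (λ v → ind (w ℍ.≟ v +ᴹ x)) ≡ 1
    solution w = ∑ᴴ.count-unique (λ v → w ℍ.≟ v +ᴹ x) (λ eq p → ≈ᴹ-trans p (+ᴹ-congʳ eq))
      (w +ᴹ -ᴹ x) (≈ᴹ-sym (≈ᴹ-trans (+ᴹ-assoc _ _ _) (≈ᴹ-trans (+ᴹ-congˡ (-ᴹ‿inverseˡ x)) (+ᴹ-identityʳ w))))
      (λ v p → ≈ᴹ-trans (≈ᴹ-sym (+ᴹ-identityʳ v)) (≈ᴹ-trans (+ᴹ-congˡ (≈ᴹ-sym (-ᴹ‿inverseʳ x)))
        (≈ᴹ-trans (≈ᴹ-sym (+ᴹ-assoc _ _ _)) (+ᴹ-congʳ (≈ᴹ-sym p)))))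

  -- As a and h meet trivially, a + h is the disjoint union of the translates of a by the vectors of
  -- h.
  card-∈+ : ∀ {a h} → MeetTrivially a h → ∑ᴴ (λ v → ind (∈+? a h v)) ≡ card h ℕ.* card a
  card-∈+ {a} {h} meet = begin
    ∑ᴴ (λ v → ind (∈+? a h v))                                       ≡⟨ ∑ᴴ.∑-cong decomposition ⟩
    ∑ᴴ (λ v → ∑ᴴ (λ x → ind (∈? h x) ℕ.* ind (∈? a (v +ᴹ x))))
      ≡⟨ ∑-swap sizeᴴ sizeᴴ ℕₚ.+-*-semiring (λ v x → ind (∈? h x) ℕ.* ind (∈? a (v +ᴹ x))) ⟩
    ∑ᴴ (λ x → ∑ᴴ (λ v → ind (∈? h x) ℕ.* ind (∈? a (v +ᴹ x))))
      ≡⟨ ∑ᴴ.∑-cong (λ x → ≡.trans (∑ᴴ.∑-*ˡ (ind (∈? h x)) (λ v → ind (∈? a (v +ᴹ x))))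
         (cong (ind (∈? h x) ℕ.*_) (card-translate a x))) ⟩
    ∑ᴴ (λ x → ind (∈? h x) ℕ.* card a)
      ≡⟨ ∑ᴴ.∑-*ʳ (card a) (λ x → ind (∈? h x)) ⟩
    card h ℕ.* card a                                                ∎
    where
    open ≡-Reasoning
    decomposition : ∀ v → ind (∈+? a h v) ≡ ∑ᴴ (λ x → ind (∈? h x) ℕ.* ind (∈? a (v +ᴹ x)))
    decomposition v = ≡.trans split (≡.sym (∑ᴴ.∑-cong (λ x → ind-× (∈? h x) (∈? a (v +ᴹ x)))))
      where
      both? = λ x → ∈? h x ×-dec ∈? a (v +ᴹ x)
      split : ind (∈+? a h v) ≡ ∑ᴴ (λ x → ind (both? x))
      split = ≡.sym (∑ᴴ.count-witness both? (∈+? a h v)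
        (λ eq (p , r) → resp h eq p , resp a (+ᴹ-congˡ eq) r) (λ x p → x , p)
        (λ (x , p) → x , p , unique x p))
        where
        unique : ∀ x → x ∈ h × v +ᴹ x ∈ a → ∀ y → y ∈ h × v +ᴹ y ∈ a → y ≈ᴹ x
        -- The difference of v + y and v + x lies in a and equals y - x, which lies in h.
        unique x (x∈ , v+x∈) y (y∈ , v+y∈) = x∙y⁻¹≈ε⇒x≈y y x
          (≈ᴹ-trans (+ᴹ-congˡ negate) (meet _ (resp a difference (+∈ a v+y∈ (*∈ a (- 1#) v+x∈))) (+∈ h y∈ (*∈ h (- 1#) x∈))))
          where
          open GroupProperties +ᴹ-group using (x∙y⁻¹≈ε⇒x≈y; inverseʳ-unique)
          open CommutativeSemigroupProperties (CommutativeMonoid.commutativeSemigroup +ᴹ-commutativeMonoid) using (interchange)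
          negate : -ᴹ x ≈ᴹ (- 1#) *ₗ x
          negate = ≈ᴹ-sym (inverseʳ-unique x _ (cancel-negative x))
          difference : (v +ᴹ y) +ᴹ (- 1#) *ₗ (v +ᴹ x) ≈ᴹ y +ᴹ (- 1#) *ₗ x
          difference = ≈ᴹ-trans (+ᴹ-congˡ (*ₗ-distribˡ (- 1#) v x))
            (≈ᴹ-trans (interchange v y _ _) (≈ᴹ-trans (+ᴹ-congʳ (cancel-negative v)) (+ᴹ-identityˡ _)))

-- Covers in the attenuated space poset

-- The counts below have the form x w + z, where z is the number of excluded vectors and w the
-- number of vectors per cover; this reads off x without subtracting in ℕ.
*-cancelʳ-+ : ∀ {x y z} w .{{_ : NonZero w}} → x ℕ.* w ℕ.+ z ≡ y ℕ.* w ℕ.+ z → x ≡ y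
*-cancelʳ-+ {x} {y} {z} w eq = ℕₚ.*-cancelʳ-≡ x y w (ℕₚ.+-cancelʳ-≡ z _ _ eq)

module CoverCounts
  {q n : ℕ} {c ℓ m ℓm : Level} (F : FiniteField q c ℓ)
  (H : Module (FiniteField.commutativeRing F) m ℓm)
  (dimH : FiniteLinearAlgebra.Basis F H (FiniteLinearAlgebra.whole F H) n)
  (h : FiniteLinearAlgebra.Subspace F H) {r : ℕ}
  (size-X : HasSize (FiniteLinearAlgebra.FiniteDimensional.AttenuatedSpace.X-setoid F H dimH h) r) where

  open SubspaceGeometry F H dimH public
  open AttenuatedSpace h public hiding (sizeˣ)
  open Subspace using (∈?; resp; 0∈; +∈; *∈)
  open Setoid X-setoid public using () renaming (_≈_ to _≈ˣ_; refl to reflˣ; sym to symˣ; trans to transˣ)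
  open module ∑ˣ = Counting size-X public using () renaming (∑ to ∑ˣ)
  private module 𝔽 = FiniteSetoid size

  ∑ˣ-swap = λ (f : X → X → ℕ) → ∑-swap size-X size-X ℕₚ.+-*-semiring f

  -- The number q - 1 of nonzero scalars, not to be confused with the `p` of `WeightedCovers`.
  p : ℕ
  p = ℕ.pred q

  instance
    q-nonZero : NonZero q
    q-nonZero = ℕ.>-nonZero (ℕₚ.<-trans (s≤s z≤n) 1<q)

  suc-p : suc p ≡ q
  suc-p = ℕₚ.suc-pred q

  instance
    p-nonZero : NonZero p
    p-nonZero = ℕ.>-nonZero (ℕₚ.≤-pred (≡.subst (1 <_) (≡.sym suc-p) 1<q))

  q^≢0 : ∀ d → NonZero (q ℕ.^ d)
  q^≢0 d = ℕₚ.m^n≢0 q d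

  step≢0 : ∀ d → NonZero (p ℕ.* q ℕ.^ d)
  step≢0 d = ℕₚ.m*n≢0 p (q ℕ.^ d) {{p-nonZero}} {{q^≢0 d}}

  q^-step : ∀ d → p ℕ.* q ℕ.^ d ℕ.+ q ℕ.^ d ≡ q ℕ.^ suc d
  q^-step d = ≡.trans (ℕₚ.+-comm _ (q ℕ.^ d)) (cong (ℕ._* q ℕ.^ d) suc-p)

  dimˣ-cong : ∀ {y z : X} → y ≈ˣ z → dimˣ y ≡ dimˣ z
  dimˣ-cong {y} {z} (y⊆z , z⊆y) = dim-cong {space y} {space z} y⊆z z⊆y

  Covers-resp : ∀ {y y′ z z′ : X} → y ≈ˣ y′ → z ≈ˣ z′ → y Covers z → y′ Covers z′
  Covers-resp {y} {y′} {z} {z′} y≈ z≈ (z⊆y , d) =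
    (λ v → proj₁ y≈ v ∘ z⊆y v ∘ proj₂ z≈ v) ,
    ≡.trans (≡.sym (dimˣ-cong {y} {y′} y≈)) (≡.trans d (cong suc (dimˣ-cong {z} {z′} z≈)))

  ≈ˣ-by-dim : ∀ {y z : X} → space y ⊆ space z → dimˣ y ≡ dimˣ z → y ≈ˣ z
  ≈ˣ-by-dim {y} {z} y⊆z d = y⊆z , ⊆-antisym-dim {space y} {space z} y⊆z (ℕₚ.≤-reflexive (≡.sym d))

  -- A cover y of z is spanned by z and any one of its vectors outside z.
  cover-⊆ : ∀ {y z : X} {b v} → y Covers z → v ∈ space y → ¬ v ∈ space z → space z ⊆ b → v ∈ b → space y ⊆ b
  cover-⊆ {y} {z} {b} {v} (z⊆y , d) v∈y v∉z z⊆b v∈b x x∈ =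
    ⊕-least {space z} {b} z⊆b v∈b x (hyperplane-⊕ {space z} {space y} z⊆y d v∈y v∉z x x∈)

  cover-unique : ∀ {y j z : X} {v} → y Covers z → j Covers z → v ∈ space y → v ∈ space j → ¬ v ∈ space z → y ≈ˣ j
  cover-unique {y} {j} {z} cy cj v∈y v∈j v∉z =
    cover-⊆ {y} {z} {space j} cy v∈y v∉z (proj₁ cj) v∈j ,
    cover-⊆ {j} {z} {space y} cj v∈j v∉z (proj₁ cy) v∈y

  -- Let x in h satisfy x + s v ∈ a. If s = 0, then x lies in a and in h. Otherwise scaling by the
  -- inverse of s would put v into a + h.
  meet-⊕ : ∀ {a v} → MeetTrivially a h → ¬ v ∈+ a , h → MeetTrivially (a ⊕⟨ v ⟩) h
  meet-⊕ {a} {v} meet v∉ x x∈ x∈h with ⊕-elim {a} {v} x∈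
  ... | s , r with s 𝔽.≟ 0#
  ...   | yes s≈0 = meet x (resp a (≈ᴹ-trans (+ᴹ-congˡ (≈ᴹ-trans (*ₗ-congʳ s≈0) (*ₗ-zeroˡ v))) (+ᴹ-identityʳ x)) r) x∈h
  ...   | no  s≉0 = contradiction (s⁻¹ *ₗ x , *∈ h s⁻¹ x∈h , resp a unit (*∈ a s⁻¹ r)) v∉
    where
    s⁻¹ = proj₁ (FiniteField.inverse F s s≉0)
    unit : s⁻¹ *ₗ (x +ᴹ s *ₗ v) ≈ᴹ v +ᴹ s⁻¹ *ₗ x
    unit = ≈ᴹ-trans (*ₗ-distribˡ s⁻¹ x _) (≈ᴹ-trans (+ᴹ-comm _ _) (+ᴹ-congʳ
      (≈ᴹ-trans (≈ᴹ-sym (*ₗ-assoc s⁻¹ s v))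
        (≈ᴹ-trans (*ₗ-congʳ (proj₂ (FiniteField.inverse F s s≉0))) (*ₗ-identityˡ v)))))

  -- Opaque because unfolding the decision procedures makes conversion checking
  -- explode; the same holds for the other opaque definitions.
  opaque
    _⋗?_ : ∀ (y z : X) → Dec (y Covers z)
    y ⋗? z = y covers? z

  CoverIn : X → Subspace → X → Set m
  CoverIn a b j = j Covers a × space j ⊆ b

  opaque
    coverIn? : ∀ a b j → Dec (CoverIn a b j)
    coverIn? a b j = (j ⋗? a) ×-dec (space j ⊆? b)

  coversIn : X → Subspace → ℕ
  coversIn a b = ∑ˣ (λ j → ind (coverIn? a b j))

  card-cover-outside : ∀ {j a} → j Covers a →
    ∑ᴴ (λ v → ind (∈? (space j) v ×-dec ¬? (∈? (space a) v))) ≡ p ℕ.* q ℕ.^ dimˣ a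
  card-cover-outside {j} {a} (a⊆j , d) = ℕₚ.+-cancelʳ-≡ (q ℕ.^ dimˣ a) _ _ (begin
    ∑ᴴ outside ℕ.+ q ℕ.^ dimˣ a            ≡⟨ cong (∑ᴴ outside ℕ.+_) (card≡q^dim (space a)) ⟨
    ∑ᴴ outside ℕ.+ card (space a)          ≡⟨ ∑ᴴ.∑-+ outside (λ v → ind (∈? (space a) v)) ⟨
    ∑ᴴ (λ v → outside v ℕ.+ ind (∈? (space a) v))
      ≡⟨ ∑ᴴ.∑-cong (λ v → split (∈? (space j) v) (∈? (space a) v) (a⊆j v)) ⟩
    card (space j)                         ≡⟨ card≡q^dim (space j) ⟩
    q ℕ.^ dimˣ j                           ≡⟨ cong (q ℕ.^_) d ⟩
    q ℕ.^ suc (dimˣ a)                     ≡⟨ q^-step (dimˣ a) ⟨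
    p ℕ.* q ℕ.^ dimˣ a ℕ.+ q ℕ.^ dimˣ a    ∎)
    where
    open ≡-Reasoning
    outside = λ v → ind (∈? (space j) v ×-dec ¬? (∈? (space a) v))
    split : ∀ {A B : Set} (A? : Dec A) (B? : Dec B) → (B → A) → ind (A? ×-dec ¬? B?) ℕ.+ ind B? ≡ ind A?
    split (yes _) (yes _) _ = ≡.refl
    split (yes _) (no _)  _ = ≡.refl
    split (no ¬x) (yes y) f = contradiction (f y) ¬x
    split (no _)  (no _)  _ = ≡.refl

  -- Each v in b outside a + h spans together with a exactly one cover of a
  -- inside b, and each such cover contains (q - 1) q^(dim a) of these v.
  coversIn-count : ∀ a b → space a ⊆ b →
    coversIn a b ℕ.* (p ℕ.* q ℕ.^ dimˣ a) ℕ.+ ∑ᴴ (λ v → ind (∈? b v ×-dec ∈+? (space a) h v)) ≡ q ℕ.^ dim b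
  coversIn-count a b a⊆b = begin
    coversIn a b ℕ.* w ℕ.+ ∑ᴴ inside
      ≡⟨ cong (ℕ._+ ∑ᴴ inside) (∑ˣ.∑-*ʳ w (λ j → ind (coverIn? a b j))) ⟨
    ∑ˣ (λ j → ind (coverIn? a b j) ℕ.* w) ℕ.+ ∑ᴴ inside
      ≡⟨ cong (ℕ._+ ∑ᴴ inside) (∑ˣ.∑-cong weights) ⟩
    ∑ˣ (λ j → ∑ᴴ (λ v → ind (flag? v j))) ℕ.+ ∑ᴴ inside
      ≡⟨ cong (ℕ._+ ∑ᴴ inside) (∑-swap size-X sizeᴴ ℕₚ.+-*-semiring (λ j v → ind (flag? v j))) ⟩
    ∑ᴴ (λ v → ∑ˣ (λ j → ind (flag? v j))) ℕ.+ ∑ᴴ inside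
      ≡⟨ ∑ᴴ.∑-+ (λ v → ∑ˣ (λ j → ind (flag? v j))) inside ⟨
    ∑ᴴ (λ v → ∑ˣ (λ j → ind (flag? v j)) ℕ.+ inside v)
      ≡⟨ ∑ᴴ.∑-cong (λ v → ≡.trans (cong (ℕ._+ inside v) (unique-flag v)) (split (∈? b v) (∈+? (space a) h v))) ⟩
    card b                                                        ≡⟨ card≡q^dim b ⟩
    q ℕ.^ dim b                                                   ∎
    where
    open ≡-Reasoning
    w = p ℕ.* q ℕ.^ dimˣ a
    inside = λ v → ind (∈? b v ×-dec ∈+? (space a) h v)
    beyond? = λ j v → ∈? (space j) v ×-dec ¬? (∈? (space a) v)
    flag? : ∀ v j → Dec (CoverIn a b j × (v ∈ space j × ¬ v ∈ space a))
    flag? v j = coverIn? a b j ×-dec beyond? j v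
    weights : ∀ j → ind (coverIn? a b j) ℕ.* w ≡ ∑ᴴ (λ v → ind (flag? v j))
    weights j = ≡.trans (ind-*-cong (coverIn? a b j) (λ (cj , _) → ≡.sym (card-cover-outside {j} {a} cj)))
      (≡.trans (≡.sym (∑ᴴ.∑-*ˡ (ind (coverIn? a b j)) (λ v → ind (beyond? j v))))
        (∑ᴴ.∑-cong (λ v → ind-× (coverIn? a b j) (beyond? j v))))
    split : ∀ {r s} {A : Set r} {B : Set s} (A? : Dec A) (B? : Dec B) → ind (A? ×-dec ¬? B?) ℕ.+ ind (A? ×-dec B?) ≡ ind A?
    split (yes _) (yes _) = ≡.refl
    split (yes _) (no _)  = ≡.refl
    split (no _)  _       = ≡.refl
    unique-flag : ∀ v → ∑ˣ (λ j → ind (flag? v j)) ≡ ind (∈? b v ×-dec ¬? (∈+? (space a) h v))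
    unique-flag v = ∑ˣ.count-witness (flag? v) (∈? b v ×-dec ¬? (∈+? (space a) h v))
      (λ {j} {k} j≈k ((cj , j⊆b) , v∈j , v∉a) →
        (Covers-resp {j} {k} {a} {a} j≈k (reflˣ {a}) cj , λ x → j⊆b x ∘ proj₂ j≈k x) , proj₁ j≈k v v∈j , v∉a)
      -- If v + x lies in a with x in h, then x lies in j and in h, so x = 0 and v would lie in a.
      (λ j ((cj , j⊆b) , v∈j , v∉a) → j⊆b v v∈j , λ (x , x∈h , v+x∈a) → v∉a (resp (space a)
        (≈ᴹ-trans (+ᴹ-congˡ (proj₂ j x (∈-remove (space j) (resp (space j) (+ᴹ-comm v x) (proj₁ cj _ v+x∈a)) v∈j) x∈h)) (+ᴹ-identityʳ v))
        v+x∈a))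
      (λ (v∈b , v∉) →
        let v∉a : ¬ v ∈ space a
            v∉a v∈a = v∉ (0ᴹ , 0∈ h , resp (space a) (≈ᴹ-sym (+ᴹ-identityʳ v)) v∈a)
            j : X
            j = space a ⊕⟨ v ⟩ , meet-⊕ {space a} (proj₂ a) v∉
            cj : j Covers a
            cj = ⊕-base {space a} , dim-⊕ {space a} v∉a
        in j , ((cj , ⊕-least {space a} {b} a⊆b v∈b) , ⊕-direction {space a} , v∉a) ,
           λ k ((ck , _) , v∈k , _) → cover-unique {k} {j} {a} ck cj v∈k (⊕-direction {space a}) v∉a)

  -- Since b avoids h, the vectors of b in a + h are those of a, which leaves (q² - 1)/(q - 1)
  -- covers.
  coversIn-disjoint : ∀ a b → space a ⊆ b → dim b ≡ 2 ℕ.+ dimˣ a → MeetTrivially b h → coversIn a b ≡ suc q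
  coversIn-disjoint a b a⊆b d meet = *-cancelʳ-+ (p ℕ.* q ℕ.^ dimˣ a) {{step≢0 (dimˣ a)}} (begin
    coversIn a b ℕ.* (p ℕ.* q ℕ.^ dimˣ a) ℕ.+ q ℕ.^ dimˣ a
      ≡⟨ cong (coversIn a b ℕ.* (p ℕ.* q ℕ.^ dimˣ a) ℕ.+_) (≡.trans (≡.sym (card≡q^dim (space a)))
         (∑ᴴ.∑-cong (λ v → ind-cong (∈? (space a) v) (∈? b v ×-dec ∈+? (space a) h v) into (from v)))) ⟩
    _                                                        ≡⟨ coversIn-count a b a⊆b ⟩
    q ℕ.^ dim b                                              ≡⟨ cong (q ℕ.^_) d ⟩
    q ℕ.* (q ℕ.* Q)                                          ≡⟨ cong (λ q → q ℕ.* (q ℕ.* Q)) suc-p ⟨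
    suc p ℕ.* (suc p ℕ.* Q)
      ≡⟨ solve 2 (λ p Q → (con 1 :+ p) :* ((con 1 :+ p) :* Q) := (con 2 :+ p) :* (p :* Q) :+ Q) ≡.refl p Q ⟩
    suc (suc p) ℕ.* (p ℕ.* Q) ℕ.+ Q                          ≡⟨ cong (λ q → suc q ℕ.* (p ℕ.* Q) ℕ.+ Q) suc-p ⟩
    suc q ℕ.* (p ℕ.* Q) ℕ.+ Q                                ∎)
    where
    open ≡-Reasoning
    open +-*-Solver
    Q = q ℕ.^ dimˣ a
    into : ∀ {v} → v ∈ space a → v ∈ b × v ∈+ space a , h
    into {v} v∈a = a⊆b v v∈a , 0ᴹ , 0∈ h , resp (space a) (≈ᴹ-sym (+ᴹ-identityʳ v)) v∈a
    from : ∀ v → v ∈ b × v ∈+ space a , h → v ∈ space a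
    from v (v∈b , x , x∈h , r) = resp (space a)
      (≈ᴹ-trans (+ᴹ-congˡ (meet x (∈-remove b (resp b (+ᴹ-comm v x) (a⊆b _ r)) v∈b) x∈h)) (+ᴹ-identityʳ v)) r

  -- The hyperplane y of b avoids h, so b ∩ h is just the line of x and b ∩ (a + h) is a ⊕ ⟨x⟩. This
  -- leaves (q² - q)/(q - 1) covers: of the q + 1 intermediate subspaces only a ⊕ ⟨x⟩ falls outside
  -- `X`.
  coversIn-meeting : ∀ a b (y : X) x → space a ⊆ b → dim b ≡ 2 ℕ.+ dimˣ a →
    space y ⊆ b → dim b ≡ suc (dimˣ y) → x ∈ b → x ∈ h → ¬ x ≈ᴹ 0ᴹ → coversIn a b ≡ q
  coversIn-meeting a b y x a⊆b d y⊆b d′ x∈b x∈h x≉0 = *-cancelʳ-+ (p ℕ.* q ℕ.^ dimˣ a) {{step≢0 (dimˣ a)}} (begin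
    coversIn a b ℕ.* (p ℕ.* Q) ℕ.+ q ℕ.* Q
      ≡⟨ cong (coversIn a b ℕ.* (p ℕ.* Q) ℕ.+_) (≡.trans (cong (q ℕ.^_) (≡.sym (dim-⊕ {space a} (avoid a)))) (≡.trans (≡.sym (card≡q^dim (space a ⊕⟨ x ⟩)))
         (∑ᴴ.∑-cong (λ v → ind-cong (∈? (space a ⊕⟨ x ⟩) v) (∈? b v ×-dec ∈+? (space a) h v) (into v) (from v))))) ⟩
    _                                        ≡⟨ coversIn-count a b a⊆b ⟩
    q ℕ.^ dim b                              ≡⟨ cong (q ℕ.^_) d ⟩
    q ℕ.* (q ℕ.* Q)                          ≡⟨ cong (q ℕ.*_) (q^-step (dimˣ a)) ⟨
    q ℕ.* (p ℕ.* Q ℕ.+ Q)                    ≡⟨ ℕₚ.*-distribˡ-+ q _ _ ⟩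
    q ℕ.* (p ℕ.* Q) ℕ.+ q ℕ.* Q              ∎)
    where
    open ≡-Reasoning
    Q = q ℕ.^ dimˣ a
    avoid : ∀ (y : X) → ¬ x ∈ space y
    avoid y x∈y = x≉0 (proj₂ y x x∈y x∈h)
    into : ∀ v → v ∈ space a ⊕⟨ x ⟩ → v ∈ b × v ∈+ space a , h
    into v v∈ = ⊕-least {space a} {b} a⊆b x∈b v v∈ ,
      (let s , r = ⊕-elim {space a} v∈ in s *ₗ x , *∈ h s x∈h , r)
    from : ∀ v → v ∈ b × v ∈+ space a , h → v ∈ space a ⊕⟨ x ⟩
    from v (v∈b , e , e∈h , r) =
      let s , t = ⊕-elim {space y} (hyperplane-⊕ {space y} {b} y⊆b d′ x∈b (avoid y) e
                    (∈-remove b (resp b (+ᴹ-comm v e) (a⊆b _ r)) v∈b))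
          -- The vector e + s x lies in y and in h, hence vanishes, and e is a multiple of x.
          zero-part = proj₂ y _ t (+∈ h e∈h (*∈ h s x∈h))
          e-multiple = ≈ᴹ-trans (≈ᴹ-sym (cancel-multiple s e x)) (≈ᴹ-trans (+ᴹ-congʳ zero-part) (+ᴹ-identityˡ _))
      in ⊕-intro {space a} (- s) (resp (space a) (+ᴹ-congˡ e-multiple) r)

  covers : X → ℕ
  covers a = ∑ˣ (λ j → ind (j ⋗? a))

  -- This is `coversIn-count` with b the whole space, divided by q^(dim a): the excluded set a + h
  -- has |h| q^(dim a) vectors.
  covers-count : ∀ a → covers a ℕ.* p ℕ.+ card h ≡ q ℕ.^ (n ∸ dimˣ a)
  covers-count a = ℕₚ.*-cancelʳ-≡ _ _ Q {{q^≢0 (dimˣ a)}} (begin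
    (covers a ℕ.* p ℕ.+ card h) ℕ.* Q              ≡⟨ ℕₚ.*-distribʳ-+ Q (covers a ℕ.* p) (card h) ⟩
    covers a ℕ.* p ℕ.* Q ℕ.+ card h ℕ.* Q
      ≡⟨ cong₂ ℕ._+_ (≡.trans (ℕₚ.*-assoc (covers a) p Q) (cong (ℕ._* (p ℕ.* Q)) in-whole)) sum-whole ⟩
    coversIn a whole ℕ.* (p ℕ.* Q) ℕ.+ _           ≡⟨ coversIn-count a whole (λ _ _ → tt) ⟩
    q ℕ.^ dim whole
      ≡⟨ cong (q ℕ.^_) (≡.trans (dim-unique {whole} dimH) (≡.sym (ℕₚ.m∸n+n≡m (dim-bound (space a))))) ⟩
    q ℕ.^ (n ∸ dimˣ a ℕ.+ dimˣ a)                  ≡⟨ ℕₚ.^-distribˡ-+-* q (n ∸ dimˣ a) (dimˣ a) ⟩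
    q ℕ.^ (n ∸ dimˣ a) ℕ.* Q                       ∎)
    where
    open ≡-Reasoning
    Q = q ℕ.^ dimˣ a
    in-whole : covers a ≡ coversIn a whole
    in-whole = ∑ˣ.∑-cong (λ j → ind-cong (j ⋗? a) (coverIn? a whole j) (λ cj → cj , λ _ _ → tt) proj₁)
    sum-whole : card h ℕ.* Q ≡ ∑ᴴ (λ v → ind (∈? whole v ×-dec ∈+? (space a) h v))
    sum-whole = ≡.trans (cong (card h ℕ.*_) (≡.sym (card≡q^dim (space a))))
      (≡.trans (≡.sym (card-∈+ {space a} {h} (proj₂ a)))
        (∑ᴴ.∑-cong (λ v → ind-cong (∈+? (space a) h v) (∈? whole v ×-dec ∈+? (space a) h v) (tt ,_) proj₂)))

  -- The two instances of `covers-count` differ by (q - 1) q^(n - dim y) on the right, and |h|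
  -- cancels on the left.
  covers-step : ∀ {y z} → y Covers z → covers z ≡ covers y ℕ.+ q ℕ.^ (n ∸ dimˣ y)
  covers-step {y} {z} (_ , d) = *-cancelʳ-+ p (begin
    covers z ℕ.* p ℕ.+ card h                        ≡⟨ covers-count z ⟩
    q ℕ.^ (n ∸ dimˣ z)
      ≡⟨ cong (q ℕ.^_) (≡.trans (≡.sym (ℕₚ.+-∸-assoc 1 {n} (dim-bound (space y)))) (cong (suc n ∸_) d)) ⟨
    q ℕ.^ suc (n ∸ dimˣ y)                           ≡⟨ q^-step (n ∸ dimˣ y) ⟨
    p ℕ.* Q ℕ.+ Q                                    ≡⟨ cong (p ℕ.* Q ℕ.+_) (covers-count y) ⟨
    p ℕ.* Q ℕ.+ (covers y ℕ.* p ℕ.+ card h)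
      ≡⟨ solve 4 (λ p Q k e → p :* Q :+ (k :* p :+ e) := (k :+ Q) :* p :+ e) ≡.refl p Q (covers y) (card h) ⟩
    (covers y ℕ.+ Q) ℕ.* p ℕ.+ card h                ∎)
    where
    open ≡-Reasoning
    open +-*-Solver
    Q = q ℕ.^ (n ∸ dimˣ y)

-- The counting identity

module CoverRelation
  {q n : ℕ} {c ℓ m ℓm : Level} (F : FiniteField q c ℓ)
  (H : Module (FiniteField.commutativeRing F) m ℓm)
  (dimH : FiniteLinearAlgebra.Basis F H (FiniteLinearAlgebra.whole F H) n)
  (h : FiniteLinearAlgebra.Subspace F H) {r : ℕ}
  (size-X : HasSize (FiniteLinearAlgebra.FiniteDimensional.AttenuatedSpace.X-setoid F H dimH h) r) where

  open CoverCounts F H dimH h size-X public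
  open Subspace using (∈?; resp; 0∈; +∈; *∈)

  cov : X → X → ℕ
  cov y z = ind (y ⋗? z)

  Above₂ : X → X → Set m
  Above₂ b a = space a ⊆ space b × dimˣ b ≡ 2 ℕ.+ dimˣ a

  opaque
    above₂? : ∀ b a → Dec (Above₂ b a)
    above₂? b a = (space a ⊆? space b) ×-dec (dimˣ b ℕₚ.≟ 2 ℕ.+ dimˣ a)

  covers-covers⇒above₂ : ∀ {b w a : X} → b Covers w → w Covers a → Above₂ b a
  covers-covers⇒above₂ (w⊆b , d) (a⊆w , d′) = (λ v → w⊆b v ∘ a⊆w v) , ≡.trans d (cong suc d′)

  coversIn≡∑ : ∀ b a → Above₂ b a → ∑ˣ (λ w → cov b w ℕ.* cov w a) ≡ coversIn a (space b)
  coversIn≡∑ b a (a⊆b , d) = ∑ˣ.∑-cong (λ w → ≡.trans (ind-× (b ⋗? w) (w ⋗? a))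
    (ind-cong ((b ⋗? w) ×-dec (w ⋗? a)) (coverIn? a (space b) w)
      (λ ((w⊆b , _) , cw) → cw , w⊆b)
      (λ (cw , w⊆b) → (w⊆b , ≡.trans d (cong suc (≡.sym (proj₂ cw)))) , cw)))

  between : ∀ b a → ∑ˣ (λ w → cov b w ℕ.* cov w a) ≡ suc q ℕ.* ind (above₂? b a)
  between b a = go (above₂? b a)
    where
    go : (d : Dec (Above₂ b a)) → ∑ˣ (λ w → cov b w ℕ.* cov w a) ≡ suc q ℕ.* ind d
    go (yes above) = ≡.trans (coversIn≡∑ b a above)
      (≡.trans (coversIn-disjoint a (space b) (proj₁ above) (proj₂ above) (proj₂ b)) (≡.sym (ℕₚ.*-identityʳ _)))
    go (no ¬above) = ≡.trans (∑ˣ.∑-zero (λ w → ≡.trans (ind-× (b ⋗? w) (w ⋗? a))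
        (ind-no ((b ⋗? w) ×-dec (w ⋗? a)) (λ (cb , cw) → ¬above (covers-covers⇒above₂ {b} {w} {a} cb cw)))))
      (≡.sym (ℕₚ.*-zeroʳ (suc q)))

  meetˣ : X → Subspace → X
  meetˣ y a = space y ∩ a , λ v (v∈y , _) → proj₂ y v v∈y

  ≉⇒⊈ : ∀ {y z : X} → dimˣ y ≡ dimˣ z → ¬ y ≈ˣ z → ¬ space y ⊆ space z
  ≉⇒⊈ {y} {z} d y≉z y⊆z = y≉z (≈ˣ-by-dim {y} {z} y⊆z d)

  -- Two distinct hyperplanes of b meet in a hyperplane of each. Here b is only a subspace, not an
  -- element of `X`, because it has to be allowed to meet h.
  module Hyperplanes (y z : X) {b : Subspace} (y⊆b : space y ⊆ b) (z⊆b : space z ⊆ b)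
    (dy : dim b ≡ suc (dimˣ y)) (dz : dim b ≡ suc (dimˣ z)) (y≉z : ¬ y ≈ˣ z) where

    meet : X
    meet = meetˣ y (space z)

    y-covers-meet : y Covers meet
    y-covers-meet = (λ _ → proj₁) ,
      dim-∩-hyperplane {space z} {b} {space y} z⊆b dz y⊆b
        (≉⇒⊈ {y} {z} (ℕₚ.suc-injective (≡.trans (≡.sym dy) dz)) y≉z)

    z-covers-meet : z Covers meet
    z-covers-meet = (λ _ → proj₂) ,
      ≡.trans (ℕₚ.suc-injective (≡.trans (≡.sym dz) dy)) (proj₂ y-covers-meet)

    meet-unique : ∀ w → y Covers w → z Covers w → w ≈ˣ meet
    meet-unique w cy cz = ≈ˣ-by-dim {w} {meet} (λ v p → proj₁ cy v p , proj₁ cz v p)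
      (ℕₚ.suc-injective (≡.trans (≡.sym (proj₂ cy)) (proj₂ y-covers-meet)))

    common-lower : ∑ˣ (λ w → cov y w ℕ.* cov z w) ≡ 1
    common-lower = ≡.trans (∑ˣ.∑-cong (λ w → ind-× (y ⋗? w) (z ⋗? w)))
      (∑ˣ.count-unique (λ w → (y ⋗? w) ×-dec (z ⋗? w))
        (λ {w} {w′} w≈ (cy , cz) → Covers-resp {y} {y} {w} {w′} (reflˣ {y}) w≈ cy , Covers-resp {z} {z} {w} {w′} (reflˣ {z}) w≈ cz)
        meet (y-covers-meet , z-covers-meet) (λ w (cy , cz) → meet-unique w cy cz))

  opaque
    _≈ˣ?_ : ∀ (y z : X) → Dec (y ≈ˣ z)
    y ≈ˣ? z = y ≟ˣ z

  -- Products of U = cov and D = Uᵀ.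
  UUD UDU DUU S T : X → X → ℕ
  UUD y z = ∑ˣ (λ j → ∑ˣ (λ k → cov y k ℕ.* cov k j ℕ.* cov z j))
  UDU y z = ∑ˣ (λ j → ∑ˣ (λ k → cov y k ℕ.* cov j k ℕ.* cov j z))
  DUU y z = ∑ˣ (λ j → ∑ˣ (λ k → cov k y ℕ.* cov k j ℕ.* cov j z))
  S   y z = ∑ˣ (λ w → ind (above₂? y w) ℕ.* cov z w)
  T   y z = ∑ˣ (λ w → cov w y ℕ.* ind (above₂? w z))

  UUD≡ : ∀ y z → UUD y z ≡ suc q ℕ.* S y z
  UUD≡ y z = ≡.trans
    (∑ˣ.∑-cong (λ j → ≡.trans (∑ˣ.∑-*ʳ (cov z j) (λ k → cov y k ℕ.* cov k j))
      (≡.trans (cong (ℕ._* cov z j) (between y j)) (ℕₚ.*-assoc (suc q) (ind (above₂? y j)) (cov z j)))))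
    (∑ˣ.∑-*ˡ (suc q) (λ w → ind (above₂? y w) ℕ.* cov z w))

  DUU≡ : ∀ y z → DUU y z ≡ suc q ℕ.* T y z
  DUU≡ y z = ≡.trans (∑ˣ-swap (λ j k → cov k y ℕ.* cov k j ℕ.* cov j z)) (≡.trans
    (∑ˣ.∑-cong (λ k → ≡.trans (∑ˣ.∑-cong (λ j → ℕₚ.*-assoc (cov k y) (cov k j) (cov j z)))
      (≡.trans (∑ˣ.∑-*ˡ (cov k y) (λ j → cov k j ℕ.* cov j z))
      (≡.trans (cong (cov k y ℕ.*_) (between k z)) (exchange (cov k y) (ind (above₂? k z)))))))
    (∑ˣ.∑-*ˡ (suc q) (λ k → cov k y ℕ.* ind (above₂? k z))))
    where
    open +-*-Solver
    exchange : ∀ x t → x ℕ.* (suc q ℕ.* t) ≡ suc q ℕ.* (x ℕ.* t)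
    exchange x t = solve 3 (λ x s t → x :* (s :* t) := s :* (x :* t)) ≡.refl x (suc q) t

  -- Entry (y, z) of the counting identity after division by q + 1, with all terms positive.
  Relation : X → X → Set
  Relation y z = UDU y z ≡ q ℕ.* S y z ℕ.+ T y z ℕ.+ q ℕ.^ (n ∸ dimˣ y) ℕ.* cov y z

  private
    lower-resp : ∀ {y w w′ : X} → w ≈ˣ w′ → y Covers w → y Covers w′
    lower-resp {y} {w} {w′} = Covers-resp {y} {y} {w} {w′} (reflˣ {y})

    upper-resp : ∀ {y y′ w : X} → y ≈ˣ y′ → y Covers w → y′ Covers w
    upper-resp {y} {y′} {w} eq = Covers-resp {y} {y′} {w} {w} eq (reflˣ {w})

  -- The entries where y covers z

  module Covering {y z : X} (cyz : y Covers z) where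

    open ≡-Reasoning

    other? : ∀ k → Dec (y Covers k × ¬ k ≈ˣ z)
    other? k = (y ⋗? k) ×-dec ¬? (k ≈ˣ? z)

    other same : X → ℕ
    other k = ind (other? k)
    same k = ind (k ≈ˣ? z)

    other+same : ∀ k → other k ℕ.+ same k ≡ cov y k
    other+same k = go (y ⋗? k) (k ≈ˣ? z) (λ k≈z → lower-resp {y} {z} {k} (symˣ {k} {z} k≈z) cyz)
      where
      go : ∀ {r s} {A : Set r} {B : Set s} (A? : Dec A) (B? : Dec B) → (B → A) →
           ind (A? ×-dec ¬? B?) ℕ.+ ind B? ≡ ind A?
      go (yes _) (yes _) _ = ≡.refl
      go (yes _) (no _)  _ = ≡.refl
      go (no ¬x) (yes b) f = contradiction (f b) ¬x
      go (no _)  (no _)  _ = ≡.refl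

    module Other {k : X} (o : y Covers k × ¬ k ≈ˣ z) =
      Hyperplanes k z {space y} (proj₁ (proj₁ o)) (proj₁ cyz) (proj₂ (proj₁ o)) (proj₂ cyz) (proj₂ o)

    -- Some vector of k lies outside z. Every common cover j of k and z contains it, so j and y are
    -- the same cover of z.
    upper-of-other : ∀ {k} → y Covers k × ¬ k ≈ˣ z → ∑ˣ (λ j → cov j k ℕ.* cov j z) ≡ 1
    upper-of-other {k} o@(cyk , k≉z) = ≡.trans (∑ˣ.∑-cong (λ j → ind-× (j ⋗? k) (j ⋗? z)))
      (∑ˣ.count-unique (λ j → (j ⋗? k) ×-dec (j ⋗? z))
        (λ {j} {j′} j≈ (p , r) → upper-resp {j} {j′} {k} j≈ p , upper-resp {j} {j′} {z} j≈ r)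
        y (cyk , cyz)
        λ j (cjk , cjz) →
          let s , s∈k , s∉z = ⊈⇒outside {space z} {space k}
                (≉⇒⊈ {k} {z} (ℕₚ.suc-injective (≡.trans (≡.sym (proj₂ cyk)) (proj₂ cyz))) k≉z)
          in cover-unique {j} {y} {z} cjz cyz (proj₁ cjk s s∈k) (proj₁ cyk s s∈k) s∉z)

    ∑same : ∀ {f : X → ℕ} → (∀ {k k′} → k ≈ˣ k′ → f k ≡ f k′) → ∑ˣ (λ k → same k ℕ.* f k) ≡ f z
    ∑same {f} f-resp = ≡.trans (∑ˣ.∑-cong (λ k → ind-*-cong (k ≈ˣ? z) (f-resp {k} {z})))
      (≡.trans (∑ˣ.∑-*ʳ (f z) same) (≡.trans (cong (ℕ._* f z)
        (∑ˣ.count-unique (_≈ˣ? z) (λ {k} {k′} k≈ p → transˣ {k′} {k} {z} (symˣ {k} {k′} k≈) p) z (reflˣ {z}) (λ _ p → p)))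
        (ℕₚ.*-identityˡ _)))

    cov-square : ∀ j → cov j z ℕ.* cov j z ≡ cov j z
    cov-square j = ≡.trans (ind-*-cong (j ⋗? z) (ind-yes (j ⋗? z))) (ℕₚ.*-identityʳ (cov j z))

    ups : X → ℕ
    ups k = ∑ˣ (λ j → cov j k ℕ.* cov j z)

    ups-resp : ∀ {k k′ : X} → k ≈ˣ k′ → ups k ≡ ups k′
    ups-resp {k} {k′} k≈ = ∑ˣ.∑-cong (λ j → cong (ℕ._* cov j z)
      (ind-cong (j ⋗? k) (j ⋗? k′) (lower-resp {j} {k} {k′} k≈) (lower-resp {j} {k′} {k} (symˣ {k} {k′} k≈))))

    -- For a lower neighbour k ≠ z of y the middle element j can only be y. For k = z it can be any
    -- cover of z, and the factor `cov j z` occurs twice.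
    UDU-split : UDU y z ≡ ∑ˣ other ℕ.+ covers z
    UDU-split = begin
      UDU y z
        ≡⟨ ∑ˣ-swap (λ j k → cov y k ℕ.* cov j k ℕ.* cov j z) ⟩
      ∑ˣ (λ k → ∑ˣ (λ j → cov y k ℕ.* cov j k ℕ.* cov j z))
        ≡⟨ ∑ˣ.∑-cong (λ k → ≡.trans (∑ˣ.∑-cong (λ j → ℕₚ.*-assoc (cov y k) (cov j k) (cov j z)))
           (∑ˣ.∑-*ˡ (cov y k) (λ j → cov j k ℕ.* cov j z))) ⟩
      ∑ˣ (λ k → cov y k ℕ.* ups k)
        ≡⟨ ∑ˣ.∑-cong (λ k → ≡.trans (cong (ℕ._* ups k) (≡.sym (other+same k)))
           (ℕₚ.*-distribʳ-+ (ups k) (other k) (same k))) ⟩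
      ∑ˣ (λ k → other k ℕ.* ups k ℕ.+ same k ℕ.* ups k)
        ≡⟨ ∑ˣ.∑-+ (λ k → other k ℕ.* ups k) (λ k → same k ℕ.* ups k) ⟩
      ∑ˣ (λ k → other k ℕ.* ups k) ℕ.+ ∑ˣ (λ k → same k ℕ.* ups k)
        ≡⟨ cong₂ ℕ._+_
           (∑ˣ.∑-cong (λ k → ≡.trans (ind-*-cong (other? k) (upper-of-other {k})) (ℕₚ.*-identityʳ (other k))))
           (≡.trans (∑same {ups} (λ {k} {k′} → ups-resp {k} {k′})) (∑ˣ.∑-cong cov-square)) ⟩
      ∑ˣ other ℕ.+ covers z                                          ∎

    other-above : ∀ w → z Covers w → ∑ˣ (λ k → other k ℕ.* cov k w) ≡ q
    other-above w czw = ℕₚ.+-cancelʳ-≡ 1 _ _ (begin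
      ∑ˣ (λ k → other k ℕ.* cov k w) ℕ.+ 1
        ≡⟨ cong (∑ˣ (λ k → other k ℕ.* cov k w) ℕ.+_)
           (≡.trans (≡.sym (ind-yes (z ⋗? w) czw)) (≡.sym (∑same {λ k → cov k w} (λ {k} {k′} k≈ →
           ind-cong (k ⋗? w) (k′ ⋗? w) (upper-resp {k} {k′} {w} k≈) (upper-resp {k′} {k} {w} (symˣ {k} {k′} k≈)))))) ⟩
      ∑ˣ (λ k → other k ℕ.* cov k w) ℕ.+ ∑ˣ (λ k → same k ℕ.* cov k w)
        ≡⟨ ∑ˣ.∑-+ (λ k → other k ℕ.* cov k w) (λ k → same k ℕ.* cov k w) ⟨
      ∑ˣ (λ k → other k ℕ.* cov k w ℕ.+ same k ℕ.* cov k w)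
        ≡⟨ ∑ˣ.∑-cong (λ k → ≡.trans (≡.sym (ℕₚ.*-distribʳ-+ (cov k w) (other k) (same k))) (cong (ℕ._* cov k w) (other+same k))) ⟩
      ∑ˣ (λ k → cov y k ℕ.* cov k w)                                       ≡⟨ between y w ⟩
      suc q ℕ.* ind (above₂? y w)
        ≡⟨ cong (suc q ℕ.*_) (ind-yes (above₂? y w) (covers-covers⇒above₂ {y} {z} {w} cyz czw)) ⟩
      suc q ℕ.* 1                                                          ≡⟨ ℕₚ.*-identityʳ _ ⟩
      suc q                                                                ≡⟨ ℕₚ.+-comm 1 q ⟩
      q ℕ.+ 1                                                              ∎)

    -- Double count of the pairs (k, w) with w below both k and z. Each k determines w = k ∩ z, and
    -- each w admits all q + 1 elements between w and y except z.
    ∑other : ∑ˣ other ≡ q ℕ.* ∑ˣ (λ w → cov z w)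
    ∑other = begin
      ∑ˣ other
        ≡⟨ ∑ˣ.∑-cong (λ k → ≡.trans (≡.sym (ℕₚ.*-identityʳ (other k)))
           (ind-*-cong (other? k) (λ o → ≡.sym (Other.common-lower {k} o)))) ⟩
      ∑ˣ (λ k → other k ℕ.* ∑ˣ (λ w → cov k w ℕ.* cov z w))
        ≡⟨ ∑ˣ.∑-cong (λ k → ≡.sym (∑ˣ.∑-*ˡ (other k) (λ w → cov k w ℕ.* cov z w))) ⟩
      ∑ˣ (λ k → ∑ˣ (λ w → other k ℕ.* (cov k w ℕ.* cov z w)))
        ≡⟨ ∑ˣ-swap (λ k w → other k ℕ.* (cov k w ℕ.* cov z w)) ⟩
      ∑ˣ (λ w → ∑ˣ (λ k → other k ℕ.* (cov k w ℕ.* cov z w)))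
        ≡⟨ ∑ˣ.∑-cong (λ w → ≡.trans (∑ˣ.∑-cong (λ k → rotate (other k) (cov k w) (cov z w)))
           (∑ˣ.∑-*ˡ (cov z w) (λ k → other k ℕ.* cov k w))) ⟩
      ∑ˣ (λ w → cov z w ℕ.* ∑ˣ (λ k → other k ℕ.* cov k w))
        ≡⟨ ∑ˣ.∑-cong (λ w → ≡.trans (ind-*-cong (z ⋗? w) (other-above w)) (ℕₚ.*-comm (cov z w) q)) ⟩
      ∑ˣ (λ w → q ℕ.* cov z w)                                    ≡⟨ ∑ˣ.∑-*ˡ q (cov z) ⟩
      q ℕ.* ∑ˣ (λ w → cov z w)                                    ∎
      where
      open +-*-Solver
      rotate : ∀ x u t → x ℕ.* (u ℕ.* t) ≡ t ℕ.* (x ℕ.* u)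
      rotate = solve 3 (λ x u t → x :* (u :* t) := t :* (x :* u)) ≡.refl

    S≡ : S y z ≡ ∑ˣ (λ w → cov z w)
    S≡ = ∑ˣ.∑-cong (λ w → ≡.trans (ℕₚ.*-comm (ind (above₂? y w)) (cov z w)) (≡.trans
      (ind-*-cong (z ⋗? w) (λ czw → ind-yes (above₂? y w) (covers-covers⇒above₂ {y} {z} {w} cyz czw)))
      (ℕₚ.*-identityʳ (cov z w))))

    T≡ : T y z ≡ covers y
    T≡ = ∑ˣ.∑-cong (λ w → ≡.trans
      (ind-*-cong (w ⋗? y) (λ cwy → ind-yes (above₂? w z) (covers-covers⇒above₂ {w} {y} {z} cwy cyz)))
      (ℕₚ.*-identityʳ (cov w y)))

    relation : Relation y z
    relation = begin
      UDU y z                                              ≡⟨ UDU-split ⟩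
      ∑ˣ other ℕ.+ covers z                                ≡⟨ cong₂ ℕ._+_ ∑other (covers-step {y} {z} cyz) ⟩
      q ℕ.* ∑ˣ (cov z) ℕ.+ (covers y ℕ.+ Q)                ≡⟨ ℕₚ.+-assoc _ (covers y) Q ⟨
      q ℕ.* ∑ˣ (cov z) ℕ.+ covers y ℕ.+ Q
        ≡⟨ cong₂ ℕ._+_ (cong₂ (λ s t → q ℕ.* s ℕ.+ t) S≡ T≡)
           (≡.trans (cong (Q ℕ.*_) (ind-yes (y ⋗? z) cyz)) (ℕₚ.*-identityʳ Q)) ⟨
      q ℕ.* S y z ℕ.+ T y z ℕ.+ Q ℕ.* cov y z              ∎
      where Q = q ℕ.^ (n ∸ dimˣ y)

  -- The entries where z is not below y but covers an element two steps below y

  module Crossing {y z μ : X} (¬cyz : ¬ y Covers z) (czμ : z Covers μ) (above : Above₂ y μ) where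

    open ≡-Reasoning

    dim-y : dimˣ y ≡ suc (dimˣ z)
    dim-y = ≡.trans (proj₂ above) (cong suc (≡.sym (proj₂ czμ)))

    z⊈y : ¬ space z ⊆ space y
    z⊈y z⊆y = ¬cyz (z⊆y , dim-y)

    direction : ∃ λ s → s ∈ space z × ¬ s ∈ space y
    direction = ⊈⇒outside {space y} {space z} z⊈y

    s : Carrierᴹ
    s = proj₁ direction

    s∈z : s ∈ space z
    s∈z = proj₁ (proj₂ direction)

    s∉y : ¬ s ∈ space y
    s∉y = proj₂ (proj₂ direction)

    -- This is y + z: as z covers μ and μ lies in y, one vector of z outside y is enough.
    b : Subspace
    b = space y ⊕⟨ s ⟩

    y⊆b : space y ⊆ b
    y⊆b = ⊕-base {space y}

    z⊆b : space z ⊆ b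
    z⊆b = cover-⊆ {z} {μ} {b} czμ s∈z (s∉y ∘ proj₁ above s) (λ v → y⊆b v ∘ proj₁ above v) (⊕-direction {space y})

    dim-b : dim b ≡ suc (dimˣ y)
    dim-b = dim-⊕ {space y} s∉y

    dim-b′ : dim b ≡ 2 ℕ.+ dimˣ z
    dim-b′ = ≡.trans dim-b (cong suc dim-y)

    S≡1 : S y z ≡ 1
    S≡1 = ≡.trans (∑ˣ.∑-cong (λ w → ind-× (above₂? y w) (z ⋗? w)))
      (∑ˣ.count-unique (λ w → above₂? y w ×-dec (z ⋗? w))
        (λ {w} {w′} w≈ ((w⊆y , d) , czw) →
          ((λ v → w⊆y v ∘ proj₂ w≈ v) , ≡.trans d (cong (2 ℕ.+_) (dimˣ-cong {w} {w′} w≈))) , lower-resp {z} {w} {w′} w≈ czw)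
        μ (above , czμ)
        (λ w (above-w , czw) → transˣ {w} {zy} {μ} (is-meet w above-w czw) (symˣ {μ} {zy} (is-meet μ above czμ))))
      where
      zy : X
      zy = meetˣ z (space y)
      is-meet : ∀ w → Above₂ y w → z Covers w → w ≈ˣ zy
      is-meet w (w⊆y , _) (w⊆z , d) = ≈ˣ-by-dim {w} {zy} (λ v p → w⊆z v p , w⊆y v p)
        (ℕₚ.suc-injective (≡.trans (≡.sym d) (dim-∩-hyperplane {space y} {b} {space z} y⊆b dim-b z⊆b z⊈y)))

    -- A cover j of z inside b is a hyperplane of b different from y, so j and y have exactly one
    -- common lower neighbour. A cover outside b has none with y: such a k would contain a vector of
    -- y outside z, which together with z spans j inside b.
    UDU≡ : UDU y z ≡ coversIn z b
    UDU≡ = ∑ˣ.∑-cong (λ j → ≡.trans (∑ˣ.∑-*ʳ (cov j z) (λ k → cov y k ℕ.* cov j k)) (≡.trans (ℕₚ.*-comm (∑ˣ (λ k → cov y k ℕ.* cov j k)) (cov j z))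
      (≡.trans (ind-*-cong (j ⋗? z) (lower j)) (≡.trans (ind-× (j ⋗? z) (space j ⊆? b))
        (ind-cong ((j ⋗? z) ×-dec (space j ⊆? b)) (coverIn? z b j) id id)))))
      where
      lower : ∀ j → j Covers z → ∑ˣ (λ k → cov y k ℕ.* cov j k) ≡ ind (space j ⊆? b)
      lower j cjz = go (space j ⊆? b)
        where
        dim-j : dimˣ y ≡ dimˣ j
        dim-j = ≡.trans dim-y (≡.sym (proj₂ cjz))
        go : (d : Dec (space j ⊆ b)) → ∑ˣ (λ k → cov y k ℕ.* cov j k) ≡ ind d
        go (yes j⊆b) = Hyperplanes.common-lower y j {b} y⊆b j⊆b dim-b (≡.trans dim-b (cong suc dim-j))
          (λ y≈j → z⊈y (λ v → proj₂ y≈j v ∘ proj₁ cjz v))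
        go (no j⊈b)  = ∑ˣ.∑-zero (λ k → ≡.trans (ind-× (y ⋗? k) (j ⋗? k))
          (ind-no ((y ⋗? k) ×-dec (j ⋗? k)) (λ (cyk , cjk) →
            let t , t∈k , t∉z = ⊈⇒outside {space z} {space k} (≉⇒⊈ {k} {z}
                  (ℕₚ.suc-injective (≡.trans (≡.sym (proj₂ cyk)) dim-y))
                  (λ k≈z → z⊈y (λ v → proj₁ cyk v ∘ proj₂ k≈z v)))
            in j⊈b (cover-⊆ {j} {z} {b} cjz (proj₁ cjk t t∈k) t∉z z⊆b (y⊆b t (proj₁ cyk t t∈k))))))

    -- An upper neighbour of y that contains z contains s, so it can only be b; what remains open is
    -- whether b belongs to `X`.
    T≡ : (d : Dec (∃ λ x → x ∈ b ∩ h × ¬ x ≈ᴹ 0ᴹ)) → T y z ≡ ind (¬? d)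
    T≡ d = ≡.trans (∑ˣ.∑-cong (λ w → ind-× (w ⋗? y) (above₂? w z)))
      (∑ˣ.count-witness upper? (¬? d)
        (λ {w} {w′} w≈ (cwy , z⊆w , e) → upper-resp {w} {w′} {y} w≈ cwy ,
          (λ v → proj₁ w≈ v ∘ z⊆w v) , ≡.trans (≡.sym (dimˣ-cong {w} {w′} w≈)) e)
        (λ w (cwy , z⊆w , _) (x , (x∈b , x∈h) , x≉0) →
          x≉0 (proj₂ w x (⊕-least {space y} {space w} (proj₁ cwy) (z⊆w s s∈z) x x∈b) x∈h))
        (λ none → let bˣ : X
                      bˣ = b , λ x x∈b x∈h → decidable-stable (x ℍ.≟ 0ᴹ) (λ x≉0 → none (x , (x∈b , x∈h) , x≉0))
                      c-b : bˣ Covers y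
                      c-b = y⊆b , dim-b
                  in bˣ , (c-b , z⊆b , dim-b′) ,
            λ w (cwy , z⊆w , _) → cover-unique {w} {bˣ} {y} cwy c-b (z⊆w s s∈z) (⊕-direction {space y}) s∉y))
      where
      upper? : ∀ w → Dec (w Covers y × Above₂ w z)
      upper? w = (w ⋗? y) ×-dec above₂? w z

    obstruction? : Dec (∃ λ x → x ∈ b ∩ h × ¬ x ≈ᴹ 0ᴹ)
    obstruction? = ℍ.∃? (λ eq (p , r) → resp (b ∩ h) eq p , λ e → r (≈ᴹ-trans eq e))
                        (λ x → ∈? (b ∩ h) x ×-dec ¬? (x ℍ.≟ 0ᴹ))

    relation : Relation y z
    relation = begin
      UDU y z                                       ≡⟨ UDU≡ ⟩
      coversIn z b                                  ≡⟨ count obstruction? ⟩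
      q ℕ.+ ind (¬? obstruction?)                   ≡⟨ ℕₚ.+-identityʳ _ ⟨
      q ℕ.+ ind (¬? obstruction?) ℕ.+ 0
        ≡⟨ cong₂ ℕ._+_ (cong₂ ℕ._+_ (≡.trans (cong (q ℕ.*_) S≡1) (ℕₚ.*-identityʳ q)) (T≡ obstruction?))
           (≡.trans (cong (Q ℕ.*_) (ind-no (y ⋗? z) ¬cyz)) (ℕₚ.*-zeroʳ Q)) ⟨
      q ℕ.* S y z ℕ.+ T y z ℕ.+ Q ℕ.* cov y z       ∎
      where
      Q = q ℕ.^ (n ∸ dimˣ y)
      count : (d : Dec (∃ λ x → x ∈ b ∩ h × ¬ x ≈ᴹ 0ᴹ)) → coversIn z b ≡ q ℕ.+ ind (¬? d)
      count (yes (x , (x∈b , x∈h) , x≉0)) =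
        ≡.trans (coversIn-meeting z b y x z⊆b dim-b′ y⊆b dim-b x∈b x∈h x≉0) (≡.sym (ℕₚ.+-identityʳ q))
      count (no none) = ≡.trans
        (coversIn-disjoint z b z⊆b dim-b′ (λ x x∈b x∈h → decidable-stable (x ℍ.≟ 0ᴹ) (λ x≉0 → none (x , (x∈b , x∈h) , x≉0))))
        (ℕₚ.+-comm 1 q)

  -- The entries where every term vanishes

  module Remote {y z : X} (¬cyz : ¬ y Covers z) (none : ∀ w → ¬ (z Covers w × Above₂ y w)) where

    S≡0 : S y z ≡ 0
    S≡0 = ∑ˣ.∑-zero (λ w → ≡.trans (ind-× (above₂? y w) (z ⋗? w))
      (ind-no (above₂? y w ×-dec (z ⋗? w)) (λ (a , czw) → none w (czw , a))))

    -- An element w counted by `T` has y as a hyperplane and contains z, so z ∩ y would be covered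
    -- by z and lie two steps below y, against `none`. For `UDU≡0` the offending element is k ∩ z.
    T≡0 : T y z ≡ 0
    T≡0 = ∑ˣ.∑-zero (λ w → ≡.trans (ind-× (w ⋗? y) (above₂? w z))
      (ind-no ((w ⋗? y) ×-dec above₂? w z) (λ ((y⊆w , d) , z⊆w , e) →
        let dim-y = ℕₚ.suc-injective (≡.trans (≡.sym d) e)
            dim-z = dim-∩-hyperplane {space y} {space w} {space z} y⊆w d z⊆w (λ z⊆y → ¬cyz (z⊆y , dim-y))
        in none (meetˣ z (space y)) (((λ _ → proj₁) , dim-z) , (λ _ → proj₂) , ≡.trans dim-y (cong suc dim-z)))))

    UDU≡0 : UDU y z ≡ 0
    UDU≡0 = ∑ˣ.∑-zero (λ j → ∑ˣ.∑-zero (λ k → ≡.trans (cong (ℕ._* cov j z) (ind-× (y ⋗? k) (j ⋗? k)))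
      (≡.trans (ind-× ((y ⋗? k) ×-dec (j ⋗? k)) (j ⋗? z))
      (ind-no (((y ⋗? k) ×-dec (j ⋗? k)) ×-dec (j ⋗? z))
        (λ ((cyk , cjk) , cjz) → no-path {j} {k} cyk cjk cjz)))))
      where
      no-path : ∀ {j k} → y Covers k → j Covers k → ¬ j Covers z
      no-path {j} {k} cyk cjk cjz =
        none K.meet (K.z-covers-meet , covers-covers⇒above₂ {y} {k} {K.meet} cyk K.y-covers-meet)
        where
        module K = Hyperplanes k z {space j} (proj₁ cjk) (proj₁ cjz) (proj₂ cjk) (proj₂ cjz)
          (λ k≈z → ¬cyz (lower-resp {y} {k} {z} k≈z cyk))

    relation : Relation y z
    relation = ≡.trans UDU≡0 (≡.sym (cong₂ ℕ._+_ (cong₂ ℕ._+_ (≡.trans (cong (q ℕ.*_) S≡0) (ℕₚ.*-zeroʳ q)) T≡0)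
      (≡.trans (cong (q ℕ.^ (n ∸ dimˣ y) ℕ.*_) (ind-no (y ⋗? z) ¬cyz)) (ℕₚ.*-zeroʳ (q ℕ.^ (n ∸ dimˣ y))))))

  relation : ∀ y z → Relation y z
  relation y z = by-cover (y ⋗? z)
    where
    Below : X → Set m
    Below w = z Covers w × Above₂ y w
    below-resp : ∀ {w w′} → w ≈ˣ w′ → Below w → Below w′
    below-resp {w} {w′} w≈ (czw , w⊆y , d) = lower-resp {z} {w} {w′} w≈ czw ,
      (λ v → w⊆y v ∘ proj₂ w≈ v) , ≡.trans d (cong (2 ℕ.+_) (dimˣ-cong {w} {w′} w≈))
    by-below : ¬ y Covers z → Dec (∃ Below) → Relation y z
    by-below ¬c (yes (μ , czμ , above)) = Crossing.relation {y} {z} {μ} ¬c czμ above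
    by-below ¬c (no none)               = Remote.relation {y} {z} ¬c (λ w p → none (w , p))
    by-cover : Dec (y Covers z) → Relation y z
    by-cover (yes c) = Covering.relation {y} {z} c
    by-cover (no ¬c) = by-below ¬c (FiniteSetoid.∃? size-X (λ {w} {w′} → below-resp {w} {w′}) (λ w → (z ⋗? w) ×-dec above₂? y w))

-- A ring solver with integer coefficients

module IntegerCoefficients {k ℓk : Level} (K : CommutativeRing k ℓk) where

  open CommutativeRing K hiding (zero)
  open Multiples′ semiring using (1+×; ×-homo-+; ×1-homo-*) renaming (_×_ to _·_)
  open RingProperties ring using (-‿distribˡ-*; -‿distribʳ-*; -0#≈0#; -‿involutive)
  open AbelianGroupProperties +-abelianGroup using (⁻¹-∙-comm)
  open CommutativeSemigroupProperties +-commutativeSemigroup using (interchange)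
  open SetoidReasoning setoid

  -- Coefficients come from ℤ because equality in `K` need not be decidable. With the optimised
  -- multiples `fromℤ (+ 1)` reduces to `1#`, so that `con (+ 1)` matches the literal `1#` in goals.
  fromℤ : ℤ → Carrier
  fromℤ (+ n)    = n · 1#
  fromℤ -[1+ n ] = - (suc n · 1#)

  fromℤ-⊖ : ∀ m n → fromℤ (m ⊖ n) ≈ m · 1# - n · 1#
  fromℤ-⊖ m       zero    = sym (trans (+-congˡ -0#≈0#) (+-identityʳ _))
  fromℤ-⊖ zero    (suc n) = sym (+-identityˡ _)
  fromℤ-⊖ (suc m) (suc n) = begin
    fromℤ (suc m ⊖ suc n)                   ≡⟨ ≡.cong fromℤ (ℤₚ.[1+m]⊖[1+n]≡m⊖n m n) ⟩
    fromℤ (m ⊖ n)                           ≈⟨ fromℤ-⊖ m n ⟩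
    m · 1# - n · 1#                         ≈⟨ +-identityˡ _ ⟨
    0# + (m · 1# - n · 1#)                  ≈⟨ +-congʳ (-‿inverseʳ 1#) ⟨
    (1# - 1#) + (m · 1# - n · 1#)           ≈⟨ interchange 1# (- 1#) (m · 1#) (- (n · 1#)) ⟩
    (1# + m · 1#) + (- 1# - n · 1#)
      ≈⟨ +-cong (sym (1+× m 1#)) (trans (⁻¹-∙-comm 1# (n · 1#)) (-‿cong (sym (1+× n 1#)))) ⟩
    suc m · 1# - suc n · 1#                 ∎

  fromℤ-+ : ∀ i j → fromℤ (i ℤ.+ j) ≈ fromℤ i + fromℤ j
  fromℤ-+ (+ m)    (+ n)    = ×-homo-+ 1# m n
  fromℤ-+ (+ m)    -[1+ n ] = fromℤ-⊖ m (suc n)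
  fromℤ-+ -[1+ m ] (+ n)    = trans (fromℤ-⊖ n (suc m)) (+-comm _ _)
  fromℤ-+ -[1+ m ] -[1+ n ] = begin
    - (suc (suc (m ℕ.+ n)) · 1#)
      ≈⟨ -‿cong (trans (1+× (suc (m ℕ.+ n)) 1#) (+-congˡ (1+× (m ℕ.+ n) 1#))) ⟩
    - (1# + (1# + (m ℕ.+ n) · 1#))
      ≈⟨ -‿cong (trans (sym (+-assoc _ _ _)) (trans (+-congˡ (×-homo-+ 1# m n)) (interchange 1# 1# _ _))) ⟩
    - ((1# + m · 1#) + (1# + n · 1#))       ≈⟨ -‿cong (+-cong (sym (1+× m 1#)) (sym (1+× n 1#))) ⟩
    - (suc m · 1# + suc n · 1#)             ≈⟨ ⁻¹-∙-comm _ _ ⟨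
    - (suc m · 1#) - suc n · 1#             ∎

  fromℤ-neg : ∀ i → fromℤ (ℤ.- i) ≈ - fromℤ i
  fromℤ-neg (+ zero)  = sym -0#≈0#
  fromℤ-neg (+ suc n) = refl
  fromℤ-neg -[1+ n ]  = sym (-‿involutive _)

  fromℤ-+◃ : ∀ n → fromℤ (Sign.+ ℤ.◃ n) ≈ n · 1#
  fromℤ-+◃ zero    = refl
  fromℤ-+◃ (suc n) = refl

  fromℤ--◃ : ∀ n → fromℤ (Sign.- ℤ.◃ n) ≈ - (n · 1#)
  fromℤ--◃ zero    = sym -0#≈0#
  fromℤ--◃ (suc n) = refl

  fromℤ-* : ∀ i j → fromℤ (i ℤ.* j) ≈ fromℤ i * fromℤ j
  fromℤ-* (+ m)    (+ n)    = trans (fromℤ-+◃ (m ℕ.* n)) (×1-homo-* m n)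
  fromℤ-* (+ m)    -[1+ n ] = trans (fromℤ--◃ (m ℕ.* suc n)) (trans (-‿cong (×1-homo-* m (suc n))) (-‿distribʳ-* _ _))
  fromℤ-* -[1+ m ] (+ n)    = trans (fromℤ--◃ (suc m ℕ.* n)) (trans (-‿cong (×1-homo-* (suc m) n)) (-‿distribˡ-* _ _))
  fromℤ-* -[1+ m ] -[1+ n ] = begin
    fromℤ (-[1+ m ] ℤ.* -[1+ n ])           ≈⟨ ×1-homo-* (suc m) (suc n) ⟩
    suc m · 1# * (suc n · 1#)               ≈⟨ -‿involutive _ ⟨
    - - (suc m · 1# * (suc n · 1#))         ≈⟨ -‿cong (-‿distribʳ-* _ _) ⟩
    - (suc m · 1# * - (suc n · 1#))         ≈⟨ -‿distribˡ-* _ _ ⟩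
    - (suc m · 1#) * - (suc n · 1#)         ∎

  private
    R = ACR.fromCommutativeRing K

    morphism : ℤ.+-*-rawRing ACR.-Raw-AlmostCommutative⟶ R
    morphism = record
      { ⟦_⟧    = fromℤ
      ; +-homo = fromℤ-+
      ; *-homo = fromℤ-*
      ; -‿homo = fromℤ-neg
      ; 0-homo = refl
      ; 1-homo = refl
      }

    coefficients≟ : WeaklyDecidable (ACR.Induced-equivalence morphism)
    coefficients≟ i j = Maybe.map (λ { ≡.refl → refl }) (dec⇒weaklyDec ℤₚ._≟_ i j)

  open RingSolver ℤ.+-*-rawRing R morphism coefficients≟ public

-- The relations as matrix identities

module DoubleSum
  {a ℓ k ℓk : Level} {S : Setoid a ℓ} {r : ℕ} (size : HasSize S r) (K : CommutativeRing k ℓk) where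

  open Setoid S using () renaming (Carrier to I)
  open CommutativeRing K
  open FiniteSum size semiring public
  open RingProperties ring using (-1*x≈-x)

  ∑∑ : (I → I → Carrier) → Carrier
  ∑∑ f = ∑ (λ j → ∑ (f j))

  ∑∑-cong : ∀ {f g} → (∀ j k → f j k ≈ g j k) → ∑∑ f ≈ ∑∑ g
  ∑∑-cong f≈g = ∑-cong (λ j → ∑-cong (f≈g j))

  ∑∑-+ : ∀ f g → ∑∑ (λ j k → f j k + g j k) ≈ ∑∑ f + ∑∑ g
  ∑∑-+ f g = trans (∑-cong (λ j → ∑-+ (f j) (g j))) (∑-+ (λ j → ∑ (f j)) (λ j → ∑ (g j)))

  ∑∑-*ˡ : ∀ s f → ∑∑ (λ j k → s * f j k) ≈ s * ∑∑ f
  ∑∑-*ˡ s f = trans (∑-cong (λ j → ∑-*ˡ s (f j))) (∑-*ˡ s (λ j → ∑ (f j)))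

  ∑∑-- : ∀ f g → ∑∑ (λ j k → f j k - g j k) ≈ ∑∑ f - ∑∑ g
  ∑∑-- f g = trans (∑∑-+ f (λ j k → - g j k)) (+-congˡ
    (trans (∑∑-cong (λ j k → sym (-1*x≈-x (g j k)))) (trans (∑∑-*ˡ (- 1#) g) (-1*x≈-x (∑∑ g)))))

  ∑∑-swap : ∀ f → ∑∑ f ≈ ∑∑ (λ j k → f k j)
  ∑∑-swap f = ∑-swap size size semiring f

  UUD UDU DUU : (I → I → Carrier) → I → I → Carrier
  UUD u y z = ∑∑ (λ j k → u y k * u k j * u z j)
  UDU u y z = ∑∑ (λ j k → u y k * u j k * u j z)
  DUU u y z = ∑∑ (λ j k → u k y * u k j * u j z)

-- A = U + φ Uᵀ entrywise, where U is the cover matrix u, θ = φ⁻¹ is the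
-- diagonal of D, p = q⁻¹, and Q = q^(N+M−2).
record WeightedCovers
  {a ℓ k ℓk : Level} {S : Setoid a ℓ} {r : ℕ} (size : HasSize S r) (K : CommutativeRing k ℓk) :
  Set (a ⊔ ℓ ⊔ k ⊔ ℓk) where

  open Setoid S using () renaming (Carrier to I; _≈_ to _≈ᴵ_)
  open CommutativeRing K
  open Matrices size K using (Mat)
  open DoubleSum size K using (UUD; UDU; DUU)

  field
    q p Q   : Carrier
    A D u   : Mat
    θ φ     : I → Carrier
    p*q≈1   : p * q ≈ 1#
    A-respʳ : ∀ y {z z′} → z ≈ᴵ z′ → A y z ≈ A y z′
    A-respˡ : ∀ {y y′} z → y ≈ᴵ y′ → A y z ≈ A y′ z
    θ-resp  : ∀ {y z} → y ≈ᴵ z → θ y ≈ θ z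
    A-entry : ∀ y z → A y z ≈ u y z + φ y * u z y
    D-on    : ∀ {y z} → y ≈ᴵ z → D y z ≈ θ y
    D-respˡ : ∀ {y y′} z → y ≈ᴵ y′ → D y z ≈ D y′ z
    D-off   : ∀ {y z} → ¬ y ≈ᴵ z → D y z ≈ 0#
    θφ≈1    : ∀ y → θ y * φ y ≈ 1#
    -- The ratio of θ(z) to θ(y) is known only along a cover, hence the factor u on both sides.
    u-θ     : ∀ y z → u y z * θ z ≈ q * (u y z * θ y)
    -- The power q^(N+M-dim y) is written as q² Q θ(y).
    relation : ∀ y z → (1# + q) * UDU u y z - q * UUD u y z - DUU u y z ≈ (1# + q) * (q * q * Q) * (θ y * u y z)

module TridiagonalRelations
  {a ℓ k ℓk : Level} {S : Setoid a ℓ} {r : ℕ} {size : HasSize S r} {K : CommutativeRing k ℓk}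
  (W : WeightedCovers size K) where

  open WeightedCovers W
  open Setoid S using () renaming (Carrier to I; _≈_ to _≈ᴵ_; sym to symᴵ)
  open CommutativeRing K
  open Matrices size K
  open DoubleSum size K
  open IntegerCoefficients K using (solve; _:=_; _:+_; _:*_; _:-_; :-_; con; Polynomial)
  open SetoidReasoning setoid

  ⌜1⌝ : ∀ {n} → Polynomial n
  ⌜1⌝ = con (+ 1)

  β γ : Carrier
  β = q + p
  γ = 1# - p * p

  q*p≈1 : q * p ≈ 1#
  q*p≈1 = trans (*-comm q p) p*q≈1

  unscale : ∀ {s t x y} → s * t ≈ 1# → x ≈ t * y → y ≈ s * x
  unscale {s} {t} {x} {y} st≈1 eq = begin
    y             ≈⟨ *-identityˡ y ⟨
    1# * y        ≈⟨ *-congʳ st≈1 ⟨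
    s * t * y     ≈⟨ *-assoc s t y ⟩
    s * (t * y)   ≈⟨ *-congˡ eq ⟨
    s * x         ∎

  u-θ⁻¹ : ∀ y z → u y z * θ y ≈ p * (u y z * θ z)
  u-θ⁻¹ y z = unscale p*q≈1 (u-θ y z)

  -- As φ is inverse to θ, inserting θ(z) φ(z) = 1 and removing θ(y) φ(y) transfers the ratio from
  -- `u-θ`.
  u-φ : ∀ y z → u y z * φ y ≈ q * (u y z * φ z)
  u-φ y z = begin
    u y z * φ y                      ≈⟨ *-identityʳ _ ⟨
    u y z * φ y * 1#                 ≈⟨ *-congˡ (θφ≈1 z) ⟨
    u y z * φ y * (θ z * φ z)
      ≈⟨ solve 4 (λ u f t g → u :* f :* (t :* g) := u :* t :* (f :* g)) refl (u y z) (φ y) (θ z) (φ z) ⟩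
    u y z * θ z * (φ y * φ z)        ≈⟨ *-congʳ (u-θ y z) ⟩
    q * (u y z * θ y) * (φ y * φ z)
      ≈⟨ solve 5 (λ q u f t g → q :* (u :* t) :* (f :* g) := q :* (u :* g) :* (t :* f)) refl q (u y z) (φ y) (θ y) (φ z) ⟩
    q * (u y z * φ z) * (θ y * φ y)  ≈⟨ *-congˡ (θφ≈1 y) ⟩
    q * (u y z * φ z) * 1#           ≈⟨ *-identityʳ _ ⟩
    q * (u y z * φ z)                ∎

  u-φ⁻¹ : ∀ y z → u y z * φ z ≈ p * (u y z * φ y)
  u-φ⁻¹ y z = unscale p*q≈1 (u-φ y z)

  scaleˡ : ∀ {e x s t} d → e * s ≈ x * (e * t) → d * e * s ≈ x * (d * e * t)
  scaleˡ {e} {x} {s} {t} d eq = begin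
    d * e * s         ≈⟨ *-assoc d e s ⟩
    d * (e * s)       ≈⟨ *-congˡ eq ⟩
    d * (x * (e * t)) ≈⟨ solve 4 (λ d x e t → d :* (x :* (e :* t)) := x :* (d :* e :* t)) refl d x e t ⟩
    x * (d * e * t)   ∎

  scaleʳ : ∀ {d x s t} e → d * s ≈ x * (d * t) → d * e * s ≈ x * (d * e * t)
  scaleʳ {d} {x} {s} {t} e eq = begin
    d * e * s         ≈⟨ *-congʳ (*-comm d e) ⟩
    e * d * s         ≈⟨ scaleˡ e eq ⟩
    x * (e * d * t)   ≈⟨ *-congˡ (*-congʳ (*-comm e d)) ⟩
    x * (d * e * t)   ∎

  -- Here μ is the indicator product of a two-step path with middle weight tj. For the four
  -- combinations of directions x and y are each q or p, and the mixed choices give x - β + y = 0.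
  weigh : ∀ {μ x y tz tj tk} → μ * tz ≈ x * (μ * tj) → μ * tk ≈ y * (μ * tj) →
          μ * (tz - β * tj + tk) ≈ (x - β + y) * (μ * tj)
  weigh {μ} {x} {y} {tz} {tj} {tk} ez ek = begin
    μ * (tz - β * tj + tk)
      ≈⟨ solve 5 (λ μ b tz tj tk → μ :* (tz :- b :* tj :+ tk) := μ :* tz :- b :* (μ :* tj) :+ μ :* tk) refl μ β tz tj tk ⟩
    μ * tz - β * (μ * tj) + μ * tk                       ≈⟨ +-cong (+-congʳ ez) ek ⟩
    x * (μ * tj) - β * (μ * tj) + y * (μ * tj)
      ≈⟨ solve 4 (λ x b y v → x :* v :- b :* v :+ y :* v := (x :- b :+ y) :* v) refl x β y (μ * tj) ⟩
    (x - β + y) * (μ * tj)                               ∎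

  X : I → I → I → Carrier
  X k j z = u j k * u j z - q * (u k j * u z j)

  -- The inner factor of A³A* − (β+1)A²A*A + (β+1)AA*A² − A*A³ = [A, A²A* − βAA*A + A*A²]:
  -- two steps in the same direction contribute nothing.
  pair : ∀ k j z → A k j * A j z * (θ z - β * θ j + θ k) ≈ γ * X k j z
  pair k j z = begin
    A k j * A j z * w                                        ≈⟨ *-congʳ (*-cong (A-entry k j) (A-entry j z)) ⟩
    (d + f * d′) * (e + g * e′) * w
      ≈⟨ solve 7 (λ d d′ e e′ f g w → (d :+ f :* d′) :* (e :+ g :* e′) :* w :=
         d :* e :* w :+ g :* (d :* e′ :* w) :+ f :* (d′ :* e :* w) :+ f :* g :* (d′ :* e′ :* w))
         refl d d′ e e′ f g w ⟩
    d * e * w + g * (d * e′ * w) + f * (d′ * e * w) + f * g * (d′ * e′ * w)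
      ≈⟨ +-cong (+-cong (+-cong UU UD) DU) (trans (*-congˡ DD) (zeroʳ _)) ⟩
    0# + (p - q) * (d * e′) + γ * (d′ * e) + 0#              ≈⟨ +-identityʳ _ ⟩
    0# + (p - q) * (d * e′) + γ * (d′ * e)
      ≈⟨ +-cong (trans (+-identityˡ _) (*-congʳ γq)) refl ⟩
    - (γ * q) * (d * e′) + γ * (d′ * e)
      ≈⟨ solve 4 (λ γ q v v′ → :- (γ :* q) :* v :+ γ :* v′ := γ :* (v′ :- q :* v)) refl γ q (d * e′) (d′ * e) ⟩
    γ * X k j z                                              ∎
    where
    d = u k j
    d′ = u j k
    e = u j z
    e′ = u z j
    f = φ k
    g = φ j
    w = θ z - β * θ j + θ k
    opposite : ∀ {x y} → x ≈ 0# → x * y ≈ 0#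
    opposite {x} {y} eq = trans (*-congʳ eq) (zeroˡ y)
    γq : p - q ≈ - (γ * q)
    γq = begin
      p - q                     ≈⟨ +-congʳ (*-identityʳ p) ⟨
      p * 1# - q                ≈⟨ +-congʳ (*-congˡ p*q≈1) ⟨
      p * (p * q) - q
        ≈⟨ solve 2 (λ p q → p :* (p :* q) :- q := :- ((⌜1⌝ :- p :* p) :* q)) refl p q ⟩
      - (γ * q)                 ∎
    UU : d * e * w ≈ 0#
    UU = trans (weigh (scaleˡ d (u-θ j z)) (scaleʳ e (u-θ⁻¹ k j)))
      (opposite (solve 2 (λ q p → q :- (q :+ p) :+ p := con (+ 0)) refl q p))
    DD : d′ * e′ * w ≈ 0#
    DD = trans (weigh (scaleˡ d′ (u-θ⁻¹ z j)) (scaleʳ e′ (u-θ j k)))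
      (opposite (solve 2 (λ q p → p :- (q :+ p) :+ q := con (+ 0)) refl q p))
    -- Both ends lie above j, so the weight is (2p - β) θ(j) = (p - q) θ(j), and g = φ(j) removes
    -- θ(j).
    UD : g * (d * e′ * w) ≈ (p - q) * (d * e′)
    UD = begin
      g * (d * e′ * w)
        ≈⟨ *-congˡ (weigh (scaleˡ d (u-θ⁻¹ z j)) (scaleʳ e′ (u-θ⁻¹ k j))) ⟩
      g * ((p - β + p) * (d * e′ * θ j))
        ≈⟨ solve 5 (λ g q p v t → g :* ((p :- (q :+ p) :+ p) :* (v :* t)) := (p :- q) :* v :* (t :* g)) refl g q p (d * e′) (θ j) ⟩
      (p - q) * (d * e′) * (θ j * g)                ≈⟨ *-congˡ (θφ≈1 j) ⟩
      (p - q) * (d * e′) * 1#                       ≈⟨ *-identityʳ _ ⟩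
      (p - q) * (d * e′)                            ∎
    -- Both ends lie below j, so the weight is (q - p) θ(j). Rewriting θ(j) as p θ(k) lets f = φ(k)
    -- cancel and leaves (q - p) p = γ.
    DU : f * (d′ * e * w) ≈ γ * (d′ * e)
    DU = begin
      f * (d′ * e * w)
        ≈⟨ *-congˡ (weigh (scaleˡ d′ (u-θ j z)) (scaleʳ e (u-θ j k))) ⟩
      f * ((q - β + q) * (d′ * e * θ j))            ≈⟨ *-congˡ (*-congˡ (scaleʳ e (u-θ⁻¹ j k))) ⟩
      f * ((q - β + q) * (p * (d′ * e * θ k)))
        ≈⟨ solve 5 (λ f q p v t → f :* ((q :- (q :+ p) :+ q) :* (p :* (v :* t))) := (p :* q :- p :* p) :* v :* (t :* f)) refl f q p (d′ * e) (θ k) ⟩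
      (p * q - p * p) * (d′ * e) * (θ k * f)        ≈⟨ *-cong (*-congʳ (+-congʳ p*q≈1)) (θφ≈1 k) ⟩
      γ * (d′ * e) * 1#                             ≈⟨ *-identityʳ _ ⟩
      γ * (d′ * e)                                  ∎

  return : ∀ {d e x y f g t} → d * f ≈ x * (d * t) → e * g ≈ y * (e * f) → y * x ≈ 1# → d * e * g ≈ t * (d * e)
  return {d} {e} {x} {y} {f} {g} {t} ed ee yx≈1 = begin
    d * e * g             ≈⟨ scaleˡ d ee ⟩
    y * (d * e * f)       ≈⟨ *-congˡ (scaleʳ e ed) ⟩
    y * (x * (d * e * t)) ≈⟨ *-assoc y x _ ⟨
    y * x * (d * e * t)   ≈⟨ *-congʳ yx≈1 ⟩
    1# * (d * e * t)      ≈⟨ *-identityˡ _ ⟩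
    d * e * t             ≈⟨ *-comm _ _ ⟩
    t * (d * e)           ∎

  -- Each product in `X` steps once in one direction and once back, so the ends have equal
  -- dimension. This moves φ(j) to φ(y) and makes φ(y) a common factor in `path`.
  X-φ : ∀ y k j → X y k j * φ j ≈ φ y * X y k j
  X-φ y k j = begin
    (v - q * v′) * φ j
      ≈⟨ solve 4 (λ v v′ q f → (v :- q :* v′) :* f := v :* f :- q :* (v′ :* f)) refl v v′ q (φ j) ⟩
    v * φ j - q * (v′ * φ j)
      ≈⟨ +-cong (return (u-φ k y) (u-φ⁻¹ k j) p*q≈1) (-‿cong (*-congˡ (return (u-φ⁻¹ y k) (u-φ j k) q*p≈1))) ⟩
    φ y * v - q * (φ y * v′)
      ≈⟨ solve 4 (λ v v′ q f → f :* v :- q :* (f :* v′) := f :* (v :- q :* v′)) refl v v′ q (φ y) ⟩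
    φ y * (v - q * v′)                ∎
    where
    v = u k y * u k j
    v′ = u y k * u j k

  -- With X = UᵀU - q UUᵀ these are the summands of UX - XU and of XUᵀ - UᵀX. Because X is
  -- symmetric, `raising y z j k` is `lowering z y k j`, so a single relation evaluates both sums.
  lowering raising : I → I → I → I → Carrier
  lowering y z j k = (1# + q) * (u y k * u j k * u j z) - q * (u y k * u k j * u z j) - u k y * u k j * u j z
  raising  y z j k = (1# + q) * (u z j * u k j * u k y) - q * (u z j * u j k * u y k) - u j z * u j k * u k y

  path : ∀ y z j k → A y k * A k j * A j z * (θ z - (β + 1#) * θ j + (β + 1#) * θ k - θ y)
                   ≈ γ * (lowering y z j k - φ y * raising y z j k)
  path y z j k = begin
    A y k * A k j * A j z * (θ z - (β + 1#) * θ j + (β + 1#) * θ k - θ y)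
      -- The weight is that of the last two steps minus that of the first two, which is the
      -- commutator with `A` read along one path; the shift by one step turns β into β + 1.
      ≈⟨ *-congˡ (solve 5 (λ tz tj tk ty b → tz :- (b :+ ⌜1⌝) :* tj :+ (b :+ ⌜1⌝) :* tk :- ty :=
           (tz :- b :* tj :+ tk) :- (tj :- b :* tk :+ ty)) refl (θ z) (θ j) (θ k) (θ y) β) ⟩
    A y k * A k j * A j z * ((θ z - β * θ j + θ k) - (θ j - β * θ k + θ y))
      ≈⟨ solve 5 (λ a b c w w′ → a :* b :* c :* (w :- w′) := a :* (b :* c :* w) :- (a :* b :* w′) :* c)
           refl (A y k) (A k j) (A j z) (θ z - β * θ j + θ k) (θ j - β * θ k + θ y) ⟩
    A y k * (A k j * A j z * (θ z - β * θ j + θ k)) - (A y k * A k j * (θ j - β * θ k + θ y)) * A j z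
      ≈⟨ +-cong (*-cong (A-entry y k) (pair k j z)) (-‿cong (*-cong (pair y k j) (A-entry j z))) ⟩
    (u y k + φ y * u k y) * (γ * X k j z) - (γ * X y k j) * (u j z + φ j * u z j)
      ≈⟨ solve 6 (λ d x x′ e v γ → d :* (γ :* x) :- (γ :* x′) :* (e :+ v) := γ :* (d :* x :- (x′ :* e :+ x′ :* v)))
           refl (u y k + φ y * u k y) (X k j z) (X y k j) (u j z) (φ j * u z j) γ ⟩
    γ * ((u y k + φ y * u k y) * X k j z - (X y k j * u j z + X y k j * (φ j * u z j)))
      ≈⟨ *-congˡ (+-congˡ (-‿cong (+-congˡ (trans (sym (*-assoc _ _ _)) (*-congʳ (X-φ y k j)))))) ⟩
    γ * ((u y k + φ y * u k y) * X k j z - (X y k j * u j z + φ y * X y k j * u z j))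
      ≈⟨ *-congˡ (solve 7 (λ d d′ x x′ e e′ f → (d :+ f :* d′) :* x :- (x′ :* e :+ f :* x′ :* e′) := (d :* x :- x′ :* e) :- f :* (x′ :* e′ :- d′ :* x))
           refl (u y k) (u k y) (X k j z) (X y k j) (u j z) (u z j) (φ y)) ⟩
    γ * ((u y k * X k j z - X y k j * u j z) - φ y * (X y k j * u z j - u k y * X k j z))
      ≈⟨ *-congˡ (+-cong
           (solve 7 (λ d d′ b b′ e e′ q → d :* (b′ :* e :- q :* (b :* e′)) :- (d′ :* b :- q :* (d :* b′)) :* e :=
             (⌜1⌝ :+ q) :* (d :* b′ :* e) :- q :* (d :* b :* e′) :- d′ :* b :* e)
             refl (u y k) (u k y) (u k j) (u j k) (u j z) (u z j) q)
           (-‿cong (*-congˡ (solve 7 (λ d d′ b b′ e e′ q → (d′ :* b :- q :* (d :* b′)) :* e′ :- d′ :* (b′ :* e :- q :* (b :* e′)) :=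
             (⌜1⌝ :+ q) :* (e′ :* b :* d′) :- q :* (e′ :* b′ :* d) :- e :* b′ :* d′)
             refl (u y k) (u k y) (u k j) (u j k) (u j z) (u z j) q)))) ⟩
    γ * (lowering y z j k - φ y * raising y z j k) ∎

  ∑∑-lowering : ∀ f g e → ∑∑ (λ j k → (1# + q) * f j k - q * g j k - e j k) ≈ (1# + q) * ∑∑ f - q * ∑∑ g - ∑∑ e
  ∑∑-lowering f g e = trans (∑∑-- (λ j k → (1# + q) * f j k - q * g j k) e) (+-congʳ
    (trans (∑∑-- (λ j k → (1# + q) * f j k) (λ j k → q * g j k)) (+-cong (∑∑-*ˡ (1# + q) f) (-‿cong (∑∑-*ˡ q g)))))

  ∑∑lowering≈ : ∀ y z → ∑∑ (lowering y z) ≈ (1# + q) * (q * q * Q) * (θ y * u y z)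
  ∑∑lowering≈ y z = trans (∑∑-lowering (λ j k → u y k * u j k * u j z) (λ j k → u y k * u k j * u z j) (λ j k → u k y * u k j * u j z)) (relation y z)

  ∑∑raising≈ : ∀ y z → ∑∑ (raising y z) ≈ (1# + q) * (q * q * Q) * (θ z * u z y)
  ∑∑raising≈ y z = begin
    ∑∑ (raising y z)
      ≈⟨ ∑∑-lowering (λ j k → u z j * u k j * u k y) (λ j k → u z j * u j k * u y k) (λ j k → u j z * u j k * u k y) ⟩
    (1# + q) * ∑∑ (λ j k → u z j * u k j * u k y) - q * ∑∑ (λ j k → u z j * u j k * u y k) - ∑∑ (λ j k → u j z * u j k * u k y)
      ≈⟨ +-cong (+-cong (*-congˡ (∑∑-swap (λ j k → u z j * u k j * u k y))) (-‿cong (*-congˡ (∑∑-swap (λ j k → u z j * u j k * u y k)))))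
           (-‿cong (∑∑-swap (λ j k → u j z * u j k * u k y))) ⟩
    (1# + q) * UDU u z y - q * UUD u z y - DUU u z y                   ≈⟨ relation z y ⟩
    (1# + q) * (q * q * Q) * (θ z * u z y)                       ∎

  -- A matrix product sums over one representative per class. The representative of the class of z
  -- need not be z itself, so column z is recovered from a product with `D` only up to this
  -- invariance.
  RespectsColumns : Mat → Set (a ⊔ ℓ ⊔ ℓk)
  RespectsColumns P = ∀ y {z z′} → z ≈ᴵ z′ → P y z ≈ P y z′

  RespectsRows : Mat → Set (a ⊔ ℓ ⊔ ℓk)
  RespectsRows P = ∀ {y y′} z → y ≈ᴵ y′ → P y z ≈ P y′ z

  *ₘ-respectsColumns : ∀ P {R} → RespectsColumns R → RespectsColumns (P *ₘ R)
  *ₘ-respectsColumns P resp y eq = ∑-cong (λ j → *-congˡ {P y j} (resp j eq))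

  *ₘ-D : ∀ {P} → RespectsColumns P → ∀ y z → (P *ₘ D) y z ≈ P y z * θ z
  *ₘ-D {P} resp y z = ∑-single z (λ j j≈z → *-cong (resp y j≈z) (trans (D-on j≈z) (θ-resp j≈z)))
    (λ j j≉z → trans (*-congˡ (D-off j≉z)) (zeroʳ _))

  D-*ₘ : ∀ {P} → RespectsRows P → ∀ y z → (D *ₘ P) y z ≈ θ y * P y z
  D-*ₘ {P} resp y z = ∑-single y (λ j j≈y → *-cong (D-on (symᴵ j≈y)) (resp z j≈y))
    (λ j j≉y → trans (*-congʳ (D-off (j≉y ∘ symᴵ))) (zeroˡ _))

  *ₘ-congʳ : ∀ {P P′} R → P ≈ₘ P′ → P *ₘ R ≈ₘ P′ *ₘ R
  *ₘ-congʳ R eq y z = ∑-cong (λ j → *-congʳ {R j z} (eq y j))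

  -- Sum over the paths y, k, j, z. A product of three factors `A` and one `D` has this form, with τ
  -- the value of θ at the vertex where `D` stands.
  triple : (I → I → I → I → Carrier) → Mat
  triple τ y z = ∑∑ (λ j k → A y k * A k j * A j z * τ y z j k)

  ∑-product : ∀ (f : I → I → Carrier) (g : I → Carrier) →
    ∑ (λ j → ∑ (f j) * g j) ≈ ∑∑ (λ j k → f j k * g j)
  ∑-product f g = ∑-cong (λ j → sym (∑-*ʳ (g j) (f j)))

  AAAD : ∀ y z → (A *ₘ A *ₘ A *ₘ D) y z ≈ triple (λ y z j k → θ z) y z
  AAAD y z = begin
    (A *ₘ A *ₘ A *ₘ D) y z                            ≈⟨ *ₘ-D (*ₘ-respectsColumns (A *ₘ A) A-respʳ) y z ⟩
    ∑ (λ j → ∑ (λ k → A y k * A k j) * A j z) * θ z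
      ≈⟨ *-congʳ (∑-product (λ j k → A y k * A k j) (λ j → A j z)) ⟩
    ∑∑ (λ j k → A y k * A k j * A j z) * θ z          ≈⟨ *-comm _ _ ⟩
    θ z * ∑∑ (λ j k → A y k * A k j * A j z)          ≈⟨ ∑∑-*ˡ (θ z) (λ j k → A y k * A k j * A j z) ⟨
    ∑∑ (λ j k → θ z * (A y k * A k j * A j z))
      ≈⟨ ∑∑-cong (λ j k → *-comm (θ z) (A y k * A k j * A j z)) ⟩
    triple (λ y z j k → θ z) y z                      ∎

  AADA : ∀ y z → (A *ₘ A *ₘ D *ₘ A) y z ≈ triple (λ y z j k → θ j) y z
  AADA y z = begin
    (A *ₘ A *ₘ D *ₘ A) y z
      ≈⟨ *ₘ-congʳ A (*ₘ-D (*ₘ-respectsColumns A A-respʳ)) y z ⟩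
    ∑ (λ j → ∑ (λ k → A y k * A k j) * θ j * A j z)
      ≈⟨ ∑-cong (λ j → trans (*-assoc (∑ (λ k → A y k * A k j)) (θ j) (A j z)) (*-congˡ (*-comm (θ j) (A j z)))) ⟩
    ∑ (λ j → ∑ (λ k → A y k * A k j) * (A j z * θ j))
      ≈⟨ ∑-product (λ j k → A y k * A k j) (λ j → A j z * θ j) ⟩
    ∑∑ (λ j k → A y k * A k j * (A j z * θ j))
      ≈⟨ ∑∑-cong (λ j k → sym (*-assoc (A y k * A k j) (A j z) (θ j))) ⟩
    triple (λ y z j k → θ j) y z                        ∎

  ADAA : ∀ y z → (A *ₘ D *ₘ A *ₘ A) y z ≈ triple (λ y z j k → θ k) y z
  ADAA y z = begin
    (A *ₘ D *ₘ A *ₘ A) y z                              ≈⟨ *ₘ-congʳ A (*ₘ-congʳ A (*ₘ-D A-respʳ)) y z ⟩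
    ∑ (λ j → ∑ (λ k → A y k * θ k * A k j) * A j z)
      ≈⟨ ∑-product (λ j k → A y k * θ k * A k j) (λ j → A j z) ⟩
    ∑∑ (λ j k → A y k * θ k * A k j * A j z)
      ≈⟨ ∑∑-cong (λ j k → solve 4 (λ a t b c → a :* t :* b :* c := a :* b :* c :* t)
         refl (A y k) (θ k) (A k j) (A j z)) ⟩
    triple (λ y z j k → θ k) y z                        ∎

  DAAA : ∀ y z → (D *ₘ A *ₘ A *ₘ A) y z ≈ triple (λ y z j k → θ y) y z
  DAAA y z = begin
    (D *ₘ A *ₘ A *ₘ A) y z                              ≈⟨ *ₘ-congʳ A (*ₘ-congʳ A (D-*ₘ A-respˡ)) y z ⟩
    ∑ (λ j → ∑ (λ k → θ y * A y k * A k j) * A j z)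
      ≈⟨ ∑-product (λ j k → θ y * A y k * A k j) (λ j → A j z) ⟩
    ∑∑ (λ j k → θ y * A y k * A k j * A j z)
      ≈⟨ ∑∑-cong (λ j k → solve 4 (λ a t b c → t :* a :* b :* c := a :* b :* c :* t)
         refl (A y k) (θ y) (A k j) (A j z)) ⟩
    triple (λ y z j k → θ y) y z                        ∎

  triple-combination : ∀ s (τ₁ τ₂ τ₃ τ₄ : I → I → I → I → Carrier) y z →
    triple τ₁ y z - s * triple τ₂ y z + s * triple τ₃ y z - triple τ₄ y z
      ≈ triple (λ y z j k → τ₁ y z j k - s * τ₂ y z j k + s * τ₃ y z j k - τ₄ y z j k) y z
  triple-combination s τ₁ τ₂ τ₃ τ₄ y z = sym (begin
    ∑∑ (λ j k → α j k * (τ₁ y z j k - s * τ₂ y z j k + s * τ₃ y z j k - τ₄ y z j k))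
      ≈⟨ ∑∑-cong (λ j k → solve 6 (λ α t₁ t₂ t₃ t₄ s →
           α :* (t₁ :- s :* t₂ :+ s :* t₃ :- t₄) := α :* t₁ :- s :* (α :* t₂) :+ s :* (α :* t₃) :- α :* t₄)
           refl (α j k) (τ₁ y z j k) (τ₂ y z j k) (τ₃ y z j k) (τ₄ y z j k) s) ⟩
    ∑∑ (λ j k → f₁ j k - s * f₂ j k + s * f₃ j k - f₄ j k)
      ≈⟨ trans (∑∑-- (λ j k → f₁ j k - s * f₂ j k + s * f₃ j k) f₄) (+-congʳ
         (trans (∑∑-+ (λ j k → f₁ j k - s * f₂ j k) (λ j k → s * f₃ j k)) (+-cong
         (trans (∑∑-- f₁ (λ j k → s * f₂ j k)) (+-congˡ (-‿cong (∑∑-*ˡ s f₂))))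
         (∑∑-*ˡ s f₃)))) ⟩
    triple τ₁ y z - s * triple τ₂ y z + s * triple τ₃ y z - triple τ₄ y z ∎)
    where
    α f₁ f₂ f₃ f₄ : I → I → Carrier
    α j k = A y k * A k j * A j z
    f₁ j k = α j k * τ₁ y z j k
    f₂ j k = α j k * τ₂ y z j k
    f₃ j k = α j k * τ₃ y z j k
    f₄ j k = α j k * τ₄ y z j k

  -- Both sides are γ(1+q)q²Q times θ(y)u(y,z) − φ(y)θ(z)u(z,y).
  first : A *ₘ A *ₘ A *ₘ D -ₘ (β + 1#) • (A *ₘ A *ₘ D *ₘ A) +ₘ (β + 1#) • (A *ₘ D *ₘ A *ₘ A) -ₘ D *ₘ A *ₘ A *ₘ A
          ≈ₘ (Q * ((q + 1#) * ((q + 1#) * 1#))) • (A *ₘ D -ₘ D *ₘ A)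
  first y z = begin
    (A *ₘ A *ₘ A *ₘ D) y z - (β + 1#) * (A *ₘ A *ₘ D *ₘ A) y z + (β + 1#) * (A *ₘ D *ₘ A *ₘ A) y z - (D *ₘ A *ₘ A *ₘ A) y z
      ≈⟨ +-cong (+-cong (+-cong (AAAD y z) (-‿cong (*-congˡ (AADA y z)))) (*-congˡ (ADAA y z))) (-‿cong (DAAA y z)) ⟩
    _
      ≈⟨ triple-combination (β + 1#) (λ y z j k → θ z) (λ y z j k → θ j) (λ y z j k → θ k) (λ y z j k → θ y) y z ⟩
    ∑∑ (λ j k → A y k * A k j * A j z * (θ z - (β + 1#) * θ j + (β + 1#) * θ k - θ y))
      ≈⟨ ∑∑-cong (path y z) ⟩
    ∑∑ (λ j k → γ * (lowering y z j k - φ y * raising y z j k))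
      ≈⟨ trans (∑∑-*ˡ γ (λ j k → lowering y z j k - φ y * raising y z j k)) (*-congˡ
         (trans (∑∑-- (lowering y z) (λ j k → φ y * raising y z j k)) (+-cong (∑∑lowering≈ y z)
           (-‿cong (trans (∑∑-*ˡ (φ y) (raising y z)) (*-congˡ (∑∑raising≈ y z))))))) ⟩
    γ * (s * (θ y * u y z) - φ y * (s * (θ z * u z y)))
      ≈⟨ solve 7 (λ γ s ty tz v v′ f → γ :* (s :* (ty :* v) :- f :* (s :* (tz :* v′))) := γ :* s :* (v :* ty :- f :* (v′ :* tz)))
           refl γ s (θ y) (θ z) (u y z) (u z y) (φ y) ⟩
    γ * s * (u y z * θ y - φ y * (u z y * θ z))
      ≈⟨ *-congʳ scalar ⟩
    s′ * (q - 1#) * (u y z * θ y - φ y * (u z y * θ z))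
      ≈⟨ solve 5 (λ s q v v′ f → s :* (q :- ⌜1⌝) :* (v :- f :* v′) := s :* (q :* v :+ f :* v′ :- (v :+ f :* (q :* v′))))
           refl s′ q (u y z * θ y) (u z y * θ z) (φ y) ⟩
    s′ * (q * (u y z * θ y) + φ y * (u z y * θ z) - (u y z * θ y + φ y * (q * (u z y * θ z))))
      ≈⟨ *-congˡ (+-cong (+-congʳ (u-θ y z)) (-‿cong (+-congˡ (*-congˡ (u-θ z y))))) ⟨
    s′ * (u y z * θ z + φ y * (u z y * θ z) - (u y z * θ y + φ y * (u z y * θ y)))
      ≈⟨ *-congˡ (solve 5 (λ v v′ f ty tz → v :* tz :+ f :* (v′ :* tz) :- (v :* ty :+ f :* (v′ :* ty)) := (v :+ f :* v′) :* tz :- ty :* (v :+ f :* v′))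
           refl (u y z) (u z y) (φ y) (θ y) (θ z)) ⟩
    s′ * ((u y z + φ y * u z y) * θ z - θ y * (u y z + φ y * u z y))
      ≈⟨ *-congˡ (+-cong (trans (*-congʳ (sym (A-entry y z))) (sym (*ₘ-D A-respʳ y z)))
           (-‿cong (trans (*-congˡ (sym (A-entry y z))) (sym (D-*ₘ A-respˡ y z))))) ⟩
    s′ * ((A *ₘ D) y z - (D *ₘ A) y z) ∎
    where
    s s′ : Carrier
    s = (1# + q) * (q * q * Q)
    -- The shape to which Q times the second power of `q + 1#` unfolds.
    s′ = Q * ((q + 1#) * ((q + 1#) * 1#))
    -- Since q² γ = (q + 1)(q - 1), a factor q - 1 is left over. The right-hand commutator supplies
    -- it, because θ changes by the factor q along a cover.
    scalar : γ * s ≈ s′ * (q - 1#)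
    scalar = begin
      γ * s
        ≈⟨ solve 3 (λ p q Q → (⌜1⌝ :- p :* p) :* ((⌜1⌝ :+ q) :* (q :* q :* Q)) :=
           (⌜1⌝ :+ q) :* Q :* (q :* q :- p :* q :* (p :* q))) refl p q Q ⟩
      (1# + q) * Q * (q * q - p * q * (p * q))         ≈⟨ *-congˡ (+-congˡ (-‿cong (*-cong p*q≈1 p*q≈1))) ⟩
      (1# + q) * Q * (q * q - 1# * 1#)
        ≈⟨ solve 2 (λ q Q → (⌜1⌝ :+ q) :* Q :* (q :* q :- ⌜1⌝ :* ⌜1⌝) :=
           Q :* ((q :+ ⌜1⌝) :* ((q :+ ⌜1⌝) :* ⌜1⌝)) :* (q :- ⌜1⌝)) refl q Q ⟩
      s′ * (q - 1#)                                    ∎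

  -- On an edge θ(z) = x θ(y) with x = q or x = p, and both are roots of 1 - β x + x² because p q =
  -- 1.
  second : D *ₘ D *ₘ A -ₘ β • (D *ₘ A *ₘ D) +ₘ A *ₘ D *ₘ D ≈ₘ 0ₘ
  second y z = begin
    (D *ₘ D *ₘ A) y z - β * (D *ₘ A *ₘ D) y z + (A *ₘ D *ₘ D) y z
      ≈⟨ +-cong (+-cong DDA (-‿cong (*-congˡ DAD))) ADD ⟩
    θ y * (θ y * A y z) - β * (θ y * A y z * θ z) + A y z * θ z * θ z
      ≈⟨ +-cong (+-cong (*-congˡ (*-congˡ (A-entry y z))) (-‿cong (*-congˡ (*-congʳ (*-congˡ (A-entry y z))))))
           (*-congʳ (*-congʳ (A-entry y z))) ⟩
    _
      ≈⟨ solve 6 (λ v v′ f ty tz b →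
           ty :* (ty :* (v :+ f :* v′)) :- b :* (ty :* (v :+ f :* v′) :* tz) :+ (v :+ f :* v′) :* tz :* tz :=
           (v :* ty :* ty :- b :* (v :* tz :* ty) :+ v :* tz :* tz) :+ f :* (v′ :* ty :* ty :- b :* (v′ :* tz :* ty) :+ v′ :* tz :* tz))
           refl (u y z) (u z y) (φ y) (θ y) (θ z) β ⟩
    quadratic (u y z) + φ y * quadratic (u z y)
      ≈⟨ +-cong (vanish (u-θ y z) (solve 2 (λ q p → ⌜1⌝ :- (q :+ p) :* q :+ q :* q := ⌜1⌝ :- p :* q) refl q p))
           (*-congˡ (vanish (u-θ⁻¹ z y) (solve 2 (λ q p → ⌜1⌝ :- (q :+ p) :* p :+ p :* p := ⌜1⌝ :- p :* q) refl q p))) ⟩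
    0# + φ y * 0#
      ≈⟨ trans (+-identityˡ _) (zeroʳ _) ⟩
    0# ∎
    where
    quadratic : Carrier → Carrier
    quadratic v = v * θ y * θ y - β * (v * θ z * θ y) + v * θ z * θ z
    vanish : ∀ {v x} → v * θ z ≈ x * (v * θ y) → 1# - β * x + x * x ≈ 1# - p * q → quadratic v ≈ 0#
    vanish {v} {x} eq root = begin
      v * θ y * θ y - β * (v * θ z * θ y) + v * θ z * θ z
        ≈⟨ +-cong (+-congˡ (-‿cong (*-congˡ (*-congʳ eq)))) (trans (*-congʳ eq) (trans (*-assoc x _ _) (*-congˡ
             (trans (solve 3 (λ v t s → v :* t :* s := v :* s :* t) refl v (θ y) (θ z)) (*-congʳ eq))))) ⟩
      v * θ y * θ y - β * (x * (v * θ y) * θ y) + x * (x * (v * θ y) * θ y)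
        ≈⟨ solve 4 (λ w b x t → w :* t :- b :* (x :* w :* t) :+ x :* (x :* w :* t) := (⌜1⌝ :- b :* x :+ x :* x) :* (w :* t)) refl (v * θ y) β x (θ y) ⟩
      (1# - β * x + x * x) * (v * θ y * θ y)
        ≈⟨ *-congʳ (trans root (trans (+-congˡ (-‿cong p*q≈1)) (-‿inverseʳ 1#))) ⟩
      0# * (v * θ y * θ y)
        ≈⟨ zeroˡ _ ⟩
      0# ∎
    DDA : (D *ₘ D *ₘ A) y z ≈ θ y * (θ y * A y z)
    DDA = trans (*ₘ-congʳ A (D-*ₘ D-respˡ) y z) (trans (∑-cong (λ j → *-assoc (θ y) (D y j) (A j z)))
      (trans (∑-*ˡ (θ y) (λ j → D y j * A j z)) (*-congˡ (D-*ₘ A-respˡ y z))))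
    DAD : (D *ₘ A *ₘ D) y z ≈ θ y * A y z * θ z
    DAD = trans (*ₘ-congʳ D (D-*ₘ A-respˡ) y z) (*ₘ-D {λ y z → θ y * A y z} (λ y eq → *-congˡ (A-respʳ y eq)) y z)
    ADD : (A *ₘ D *ₘ D) y z ≈ A y z * θ z * θ z
    ADD = trans (*ₘ-congʳ D (*ₘ-D A-respʳ) y z) (*ₘ-D {λ y z → A y z * θ z} (λ y eq → *-cong (A-respʳ y eq) (θ-resp eq)) y z)

-- Images of natural numbers in the coefficient ring

module NaturalImages {k ℓk : Level} (K : CommutativeRing k ℓk) where

  open CommutativeRing K hiding (zero)
  open Exponentiation semiring using (_^_)
  open SemiringMultiples semiring using (×-homo-+; ×1-homo-*)

  fromℕ-+ : ∀ x y → fromℕ K (x ℕ.+ y) ≈ fromℕ K x + fromℕ K y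
  fromℕ-+ = ×-homo-+ 1#

  fromℕ-* : ∀ x y → fromℕ K (x ℕ.* y) ≈ fromℕ K x * fromℕ K y
  fromℕ-* = ×1-homo-*

  fromℕ-1 : fromℕ K 1 ≈ 1#
  fromℕ-1 = +-identityʳ 1#

  fromℕ-^ : ∀ x d → fromℕ K (x ℕ.^ d) ≈ fromℕ K x ^ d
  fromℕ-^ x zero    = fromℕ-1
  fromℕ-^ x (suc d) = trans (fromℕ-* x (x ℕ.^ d)) (*-congˡ (fromℕ-^ x d))

  fromℕ-sum : ∀ {r} (f : Fin r → ℕ) →
    fromℕ K (Summation.sum ℕₚ.+-0-commutativeMonoid f) ≈ Summation.sum +-commutativeMonoid (fromℕ K ∘ f)
  fromℕ-sum {zero}  f = refl
  fromℕ-sum {suc r} f = trans (fromℕ-+ (f zero) _) (+-congˡ (fromℕ-sum (f ∘ suc)))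

  ^-inverse : ∀ {x y} → x * y ≈ 1# → ∀ d → x ^ d * y ^ d ≈ 1#
  ^-inverse xy≈1 zero    = *-identityˡ 1#
  ^-inverse {x} {y} xy≈1 (suc d) = trans (interchange x (x ^ d) y (y ^ d))
    (trans (*-cong xy≈1 (^-inverse xy≈1 d)) (*-identityˡ 1#))
    where
    open CommutativeSemigroupProperties *-commutativeSemigroup using (interchange)

-- The matrices of the attenuated space poset as weighted covers

module CoverMatrices
  {q n : ℕ} {c ℓ m ℓm k ℓk : Level} (F : FiniteField q c ℓ)
  (H : Module (FiniteField.commutativeRing F) m ℓm)
  (dimH : FiniteLinearAlgebra.Basis F H (FiniteLinearAlgebra.whole F H) n)
  (h : FiniteLinearAlgebra.Subspace F H) {r : ℕ}
  (size-X : HasSize (FiniteLinearAlgebra.FiniteDimensional.AttenuatedSpace.X-setoid F H dimH h) r)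
  (2≤n : 2 ≤ n) (K : CommutativeRing k ℓk) (q-inv : InvertibleIn K q) where

  open FiniteLinearAlgebra F H using (module FiniteDimensional)
  open FiniteDimensional dimH using (module AttenuatedSpace)
  open AttenuatedSpace h using (X; _Covers_; _covers?_; _≟ˣ_; dimˣ; X-setoid; module AttenuatedMatrices)
  open AttenuatedMatrices K q-inv using (A; A*; Mat; qᴷ; q⁻¹)
  open CoverRelation F H dimH h size-X
    using (cov; _⋗?_; relation; UUD≡; DUU≡; S; T; Covers-resp; dimˣ-cong; dim-bound; ∑ˣ)
    renaming (UUD to UUDℕ; UDU to UDUℕ; DUU to DUUℕ)
  open Setoid X-setoid using () renaming (_≈_ to _≈ˣ_; refl to reflˣ; sym to symˣ; trans to transˣ)
  open CommutativeRing K hiding (zero)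
  open Exponentiation semiring using (_^_; ^-homo-*; ^-congʳ)
  open NaturalImages K
  open IntegerCoefficients K using (solve; _:=_; _:+_; _:*_; _:-_; con)
  open DoubleSum size-X K using (∑-cong; ∑∑-cong; UUD; UDU; DUU; ∑∑)
  open SetoidReasoning setoid

  p*q≈1 : q⁻¹ * qᴷ ≈ 1#
  p*q≈1 = proj₁ (proj₂ q-inv)

  u : Mat
  u y z = fromℕ K (cov y z)

  θ φ : X → Carrier
  θ y = q⁻¹ ^ dimˣ y
  φ y = qᴷ ^ dimˣ y

  Q : Carrier
  Q = qᴷ ^ (n ∸ 2)

  θ-resp : ∀ {y z : X} → y ≈ˣ z → θ y ≈ θ z
  θ-resp {y} {z} eq = ^-congʳ q⁻¹ (dimˣ-cong {y} {z} eq)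

  φ-resp : ∀ {y z : X} → y ≈ˣ z → φ y ≈ φ z
  φ-resp {y} {z} eq = ^-congʳ qᴷ (dimˣ-cong {y} {z} eq)

  u-resp : ∀ {y y′ z z′ : X} → y ≈ˣ y′ → z ≈ˣ z′ → u y z ≈ u y′ z′
  u-resp {y} {y′} {z} {z′} y≈ z≈ = reflexive (≡.cong (fromℕ K) (ind-cong (y ⋗? z) (y′ ⋗? z′)
    (Covers-resp {y} {y′} {z} {z′} y≈ z≈)
    (Covers-resp {y′} {y} {z′} {z} (symˣ {y} {y′} y≈) (symˣ {z} {z′} z≈))))

  -- Two elements cannot cover each other, by dimension, so the nested conditional is a sum of two
  -- indicators.
  A-entry : ∀ y z → A y z ≈ u y z + φ y * u z y
  A-entry y z = trans (go (y covers? z) (z covers? y) antisym)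
    (reflexive (≡.cong₂ (λ s t → fromℕ K s + φ y * fromℕ K t)
      (ind-cong (y covers? z) (y ⋗? z) (λ c → c) (λ c → c))
      (ind-cong (z covers? y) (z ⋗? y) (λ c → c) (λ c → c))))
    where
    antisym : y Covers z → ¬ z Covers y
    antisym (_ , d) (_ , e) = ℕₚ.<-irrefl e (ℕₚ.≤-trans (ℕₚ.≤-reflexive (≡.sym d)) (ℕₚ.n≤1+n _))
    go : ∀ {r s} {P : Set r} {R : Set s} (P? : Dec P) (R? : Dec R) → (P → ¬ R) →
         (if does P? then 1# else if does R? then φ y else 0#) ≈ fromℕ K (ind P?) + φ y * fromℕ K (ind R?)
    go (yes x) (yes x′) excl = contradiction x′ (excl x)
    go (yes _) (no _)   _    = sym (trans (+-cong fromℕ-1 (zeroʳ _)) (+-identityʳ 1#))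
    go (no _)  (yes _)  _    = sym (trans (+-identityˡ _) (trans (*-congˡ fromℕ-1) (*-identityʳ _)))
    go (no _)  (no _)   _    = sym (trans (+-identityˡ _) (zeroʳ _))

  A-resp : ∀ {y y′ z z′ : X} → y ≈ˣ y′ → z ≈ˣ z′ → A y z ≈ A y′ z′
  A-resp {y} {y′} {z} {z′} y≈ z≈ = trans (A-entry y z) (trans
    (+-cong (u-resp {y} {y′} {z} {z′} y≈ z≈) (*-cong (φ-resp {y} {y′} y≈) (u-resp {z} {z′} {y} {y′} z≈ y≈)))
    (sym (A-entry y′ z′)))

  A*-on : ∀ {y z : X} → y ≈ˣ z → A* y z ≈ θ y
  A*-on {y} {z} y≈z = go (y ≟ˣ z)
    where
    go : (d : Dec (y ≈ˣ z)) → (if does d then θ y else 0#) ≈ θ y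
    go (yes _) = refl
    go (no y≉) = contradiction y≈z y≉

  A*-off : ∀ {y z : X} → ¬ y ≈ˣ z → A* y z ≈ 0#
  A*-off {y} {z} y≉z = go (y ≟ˣ z)
    where
    go : (d : Dec (y ≈ˣ z)) → (if does d then θ y else 0#) ≈ 0#
    go (yes y≈) = contradiction y≈ y≉z
    go (no _)   = refl

  A*-respˡ : ∀ {y y′} (z : X) → y ≈ˣ y′ → A* y z ≈ A* y′ z
  A*-respˡ {y} {y′} z y≈y′ = go (y ≟ˣ z)
    where
    go : Dec (y ≈ˣ z) → A* y z ≈ A* y′ z
    go (yes y≈z) = trans (A*-on {y} {z} y≈z) (trans (θ-resp {y} {y′} y≈y′)
      (sym (A*-on {y′} {z} (transˣ {y′} {y} {z} (symˣ {y} {y′} y≈y′) y≈z))))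
    go (no y≉z)  = trans (A*-off {y} {z} y≉z) (sym (A*-off {y′} {z} (λ y′≈z → y≉z (transˣ {y} {y′} {z} y≈y′ y′≈z))))

  u-θ : ∀ y z → u y z * θ z ≈ qᴷ * (u y z * θ y)
  u-θ y z = go (y ⋗? z)
    where
    go : (d : Dec (y Covers z)) → fromℕ K (ind d) * θ z ≈ qᴷ * (fromℕ K (ind d) * θ y)
    go (yes (_ , d)) = sym (begin
      qᴷ * (fromℕ K 1 * θ y)                ≈⟨ *-congˡ (*-congˡ (^-congʳ q⁻¹ d)) ⟩
      qᴷ * (fromℕ K 1 * (q⁻¹ * θ z))
        ≈⟨ solve 4 (λ q o p t → q :* (o :* (p :* t)) := p :* q :* (o :* t)) refl qᴷ (fromℕ K 1) q⁻¹ (θ z) ⟩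
      q⁻¹ * qᴷ * (fromℕ K 1 * θ z)          ≈⟨ *-congʳ p*q≈1 ⟩
      1# * (fromℕ K 1 * θ z)                ≈⟨ *-identityˡ _ ⟩
      fromℕ K 1 * θ z                       ∎)
    go (no _) = trans (zeroˡ _) (sym (trans (*-congˡ (zeroˡ _)) (zeroʳ _)))

  fromℕ-∑∑ : (f : X → X → ℕ) → fromℕ K (∑ˣ (λ j → ∑ˣ (f j))) ≈ ∑∑ (λ j k → fromℕ K (f j k))
  fromℕ-∑∑ f = trans (fromℕ-sum (λ i → ∑ˣ (f (to i)))) (∑-cong (λ j → fromℕ-sum (λ i → f j (to i))))
    where
    open FiniteSetoid size-X using (to)

  fromℕ-product : ∀ x y z → fromℕ K (x ℕ.* y ℕ.* z) ≈ fromℕ K x * fromℕ K y * fromℕ K z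
  fromℕ-product x y z = trans (fromℕ-* (x ℕ.* y) z) (*-congʳ (fromℕ-* x y))

  -- Both truncated differences are genuine: 2 ≤ n by `2≤n`, and dim y ≤ n.
  top-weight : ∀ y → qᴷ * qᴷ * Q * θ y ≈ qᴷ ^ (n ∸ dimˣ y)
  top-weight y = begin
    qᴷ * qᴷ * Q * θ y                           ≈⟨ *-congʳ (*-assoc qᴷ qᴷ Q) ⟩
    qᴷ ^ (2 ℕ.+ (n ∸ 2)) * θ y
      ≈⟨ *-congʳ (^-congʳ qᴷ (≡.trans (ℕₚ.m+[n∸m]≡n 2≤n) (≡.sym (ℕₚ.m∸n+n≡m (dim-bound (proj₁ y)))))) ⟩
    qᴷ ^ (n ∸ dimˣ y ℕ.+ dimˣ y) * θ y          ≈⟨ *-congʳ (^-homo-* qᴷ (n ∸ dimˣ y) (dimˣ y)) ⟩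
    qᴷ ^ (n ∸ dimˣ y) * φ y * θ y               ≈⟨ *-assoc _ _ _ ⟩
    qᴷ ^ (n ∸ dimˣ y) * (φ y * θ y)             ≈⟨ *-congˡ (trans (*-comm _ _) (^-inverse p*q≈1 (dimˣ y))) ⟩
    qᴷ ^ (n ∸ dimˣ y) * 1#                      ≈⟨ *-identityʳ _ ⟩
    qᴷ ^ (n ∸ dimˣ y)                           ∎

  -- Multiplying `relation` by q + 1 turns S and T back into `UUD` and `DUU`. The sum is written
  -- `1# + qᴷ` because the image of `suc q` unfolds to it.
  relationᴷ : ∀ y z → (1# + qᴷ) * UDU u y z - qᴷ * UUD u y z - DUU u y z ≈ (1# + qᴷ) * (qᴷ * qᴷ * Q) * (θ y * u y z)
  relationᴷ y z = begin
    (1# + qᴷ) * UDU u y z - qᴷ * UUD u y z - DUU u y z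
      ≈⟨ +-cong (+-cong (*-congˡ udu) (-‿cong (*-congˡ uud))) (-‿cong duu) ⟩
    (1# + qᴷ) * (qᴷ * s + t + w * u y z) - qᴷ * ((1# + qᴷ) * s) - (1# + qᴷ) * t
      ≈⟨ solve 5 (λ q s t w u → (con (+ 1) :+ q) :* (q :* s :+ t :+ w :* u) :- q :* ((con (+ 1) :+ q) :* s) :- (con (+ 1) :+ q) :* t
                                  := (con (+ 1) :+ q) :* (w :* u)) refl qᴷ s t w (u y z) ⟩
    (1# + qᴷ) * (w * u y z)
      ≈⟨ *-congˡ (*-congʳ (top-weight y)) ⟨
    (1# + qᴷ) * (qᴷ * qᴷ * Q * θ y * u y z)
      ≈⟨ solve 4 (λ q Q t u → (con (+ 1) :+ q) :* (q :* q :* Q :* t :* u) := (con (+ 1) :+ q) :* (q :* q :* Q) :* (t :* u)) refl qᴷ Q (θ y) (u y z) ⟩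
    (1# + qᴷ) * (qᴷ * qᴷ * Q) * (θ y * u y z) ∎
    where
    s t w : Carrier
    s = fromℕ K (S y z)
    t = fromℕ K (T y z)
    w = qᴷ ^ (n ∸ dimˣ y)
    udu : UDU u y z ≈ qᴷ * s + t + w * u y z
    udu = begin
      UDU u y z
        ≈⟨ ∑∑-cong (λ j k → sym (fromℕ-product (cov y k) (cov j k) (cov j z))) ⟩
      _                                        ≈⟨ fromℕ-∑∑ (λ j k → cov y k ℕ.* cov j k ℕ.* cov j z) ⟨
      fromℕ K (UDUℕ y z)                       ≡⟨ ≡.cong (fromℕ K) (relation y z) ⟩
      fromℕ K (q ℕ.* S y z ℕ.+ T y z ℕ.+ q ℕ.^ (n ∸ dimˣ y) ℕ.* cov y z)
        ≈⟨ trans (fromℕ-+ (q ℕ.* S y z ℕ.+ T y z) (q ℕ.^ (n ∸ dimˣ y) ℕ.* cov y z)) (+-cong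
           (trans (fromℕ-+ (q ℕ.* S y z) (T y z)) (+-congʳ (fromℕ-* q (S y z))))
           (trans (fromℕ-* (q ℕ.^ (n ∸ dimˣ y)) (cov y z)) (*-congʳ (fromℕ-^ q (n ∸ dimˣ y))))) ⟩
      qᴷ * s + t + w * u y z                   ∎
    uud : UUD u y z ≈ (1# + qᴷ) * s
    uud = begin
      UUD u y z
        ≈⟨ ∑∑-cong (λ j k → sym (fromℕ-product (cov y k) (cov k j) (cov z j))) ⟩
      _                                        ≈⟨ fromℕ-∑∑ (λ j k → cov y k ℕ.* cov k j ℕ.* cov z j) ⟨
      fromℕ K (UUDℕ y z)                       ≡⟨ ≡.cong (fromℕ K) (UUD≡ y z) ⟩
      fromℕ K (suc q ℕ.* S y z)                ≈⟨ fromℕ-* (suc q) (S y z) ⟩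
      (1# + qᴷ) * s                            ∎
    duu : DUU u y z ≈ (1# + qᴷ) * t
    duu = begin
      DUU u y z
        ≈⟨ ∑∑-cong (λ j k → sym (fromℕ-product (cov k y) (cov k j) (cov j z))) ⟩
      _                                        ≈⟨ fromℕ-∑∑ (λ j k → cov k y ℕ.* cov k j ℕ.* cov j z) ⟨
      fromℕ K (DUUℕ y z)                       ≡⟨ ≡.cong (fromℕ K) (DUU≡ y z) ⟩
      fromℕ K (suc q ℕ.* T y z)                ≈⟨ fromℕ-* (suc q) (T y z) ⟩
      (1# + qᴷ) * t                            ∎

  weightedCovers : WeightedCovers size-X K
  weightedCovers = record
    { q = qᴷ ; p = q⁻¹ ; Q = Q ; A = A ; D = A* ; u = u ; θ = θ ; φ = φ
    ; p*q≈1    = p*q≈1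
    ; A-respʳ  = λ y {z} {z′} z≈ → A-resp {y} {y} {z} {z′} (reflˣ {y}) z≈
    ; A-respˡ  = λ {y} {y′} z y≈ → A-resp {y} {y′} {z} {z} y≈ (reflˣ {z})
    ; θ-resp   = λ {y} {z} → θ-resp {y} {z}
    ; A-entry  = A-entry
    ; D-on     = λ {y} {z} → A*-on {y} {z}
    ; D-respˡ  = λ {y} {y′} → A*-respˡ {y} {y′}
    ; D-off    = λ {y} {z} → A*-off {y} {z}
    ; θφ≈1     = λ y → ^-inverse p*q≈1 (dimˣ y)
    ; u-θ      = u-θ
    ; relation = relationᴷ
    }

proposition8p6 :
    {c ℓ m ℓm k ℓk : Level} (q N M : ℕ) .{{_ : NonZero N}} .{{_ : NonZero M}}
    (F : FiniteField q c ℓ) (H : Module (FiniteField.commutativeRing F) m ℓm) →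
    let open FiniteLinearAlgebra F H in
    (dimH : Basis whole (N +ℕ M)) (h : Subspace) →
    FiniteDimensional.dim dimH h ≡ M →
    (K : CommutativeRing k ℓk) (q-inv : InvertibleIn K q) →
    let open CommutativeRing K
        open FiniteDimensional dimH
        open AttenuatedSpace h
        open AttenuatedMatrices K q-inv
        β = qᴷ + q⁻¹
    in
      ( A *ₘ A *ₘ A *ₘ A* -ₘ (β + 1#) • (A *ₘ A *ₘ A* *ₘ A)
          +ₘ (β + 1#) • (A *ₘ A* *ₘ A *ₘ A) -ₘ A* *ₘ A *ₘ A *ₘ A
        ≈ₘ (qᴷ ^ᴷ (N +ℕ M ∸ 2) * (qᴷ + 1#) ^ᴷ 2) • (A *ₘ A* -ₘ A* *ₘ A) )
      × ( A* *ₘ A* *ₘ A -ₘ β • (A* *ₘ A *ₘ A*) +ₘ A *ₘ A* *ₘ A* ≈ₘ 0ₘ )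
proposition8p6 q N M F H dimH h _ K q-inv = Relations.first , Relations.second
  where
  open FiniteLinearAlgebra.FiniteDimensional.AttenuatedSpace F H dimH h using (sizeˣ)
  2≤N+M : 2 ≤ N +ℕ M
  2≤N+M = ℕₚ.+-mono-≤ (ℕ.>-nonZero⁻¹ N) (ℕ.>-nonZero⁻¹ M)
  module Relations = TridiagonalRelations (CoverMatrices.weightedCovers F H dimH h sizeˣ 2≤N+M K q-inv)
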